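{- There exist an absolute constant $c>0$ and a $p_0$ such that for every prime $p\geq p_0$ the following holds. There are $n_0=n_0(p)$ and sets $A_n\subseteq\mathbb F_p^n$, one for each $n\geq n_0$, with density $|A_n|/p^n=\frac12+o_n(1)$ (i.e. for fixed $p$, $|A_n|/p^n\to\frac12$ as $n\to\infty$), such that for every $n\ge n_0$ \[ \max_{d\in\mathbb F_p^n\setminus\{0\}}\min\bigl\{I_3(1_{A_n})(d),\,I_3(1_{A_n})(2d)\bigr\}\leq\frac18-c. \]
   Context: For a finite set $X$, $\mathbb E_{x\in X}f(x):=\frac1{|X|}\sum_{x\in X}f(x)$. For $f:\mathbb F_p^n\to\mathbb R$ and $d\in\mathbb F_p^n\setminus\{0\}$, \[ I_3(f)(d):=\mathbb E_{x\in\mathbb F_p^n}f(x)f(x+d)f(x+2d). \] $1_A$ is the indicator function of $A$. -}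

module Defs where

open import Data.Bool.Base using (Bool; if_then_else_)
open import Data.Fin.Base using (Fin; toℕ)
open import Data.Integer.Base using (+_)
open import Data.List.Base using (List; []; _∷_; map; foldr; length; filterᵇ; allFin; cartesianProductWith)
open import Data.List.Membership.Propositional using (_∈_)
open import Data.List.Membership.Propositional.Properties using (∈-allFin; ∈-cartesianProductWith⁺)
open import Data.List.Properties using (length-tabulate; length-map; length-++)
open import Data.List.Relation.Unary.Any using (here)
open import Data.Nat.Base as ℕ using (ℕ; zero; suc; NonZero; _^_)
open import Data.Nat.DivMod using (_mod_)
open import Data.Nat.Properties using (m^n≢0)
open import Data.Product.Base using (∃-syntax; _×_)
open import Data.Rational.Base using (ℚ; 0ℚ; 1ℚ; _/_; _+_; _*_; _-_; _<_; _≤_; ∣_∣)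
import Data.Vec.Base as Vec
open Vec using (Vec; []; _∷_)
open import Relation.Binary.PropositionalEquality using (_≡_; _≢_; refl; trans; cong₂)

𝔽^ : ℕ → ℕ → Set
𝔽^ p n = Vec (Fin p) n

module _ {p : ℕ} .{{_ : NonZero p}} where

  infixl 6 _⊕_
  infixr 7 _·_

  𝟎 : ∀ {n} → 𝔽^ p n
  𝟎 = Vec.replicate _ (0 mod p)

  _⊕_ : ∀ {n} → 𝔽^ p n → 𝔽^ p n → 𝔽^ p n
  _⊕_ = Vec.zipWith λ a b → (toℕ a ℕ.+ toℕ b) mod p

  _·_ : ∀ {n} → ℕ → 𝔽^ p n → 𝔽^ p n
  k · x = Vec.map (λ a → (k ℕ.* toℕ a) mod p) x

points : ∀ p n → List (𝔽^ p n)
points p zero    = [] ∷ []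
points p (suc n) = cartesianProductWith _∷_ (allFin p) (points p n)

-- By the next two lemmas, every vector occurs in points p n exactly once.
∈-points : ∀ {p n} (x : 𝔽^ p n) → x ∈ points p n
∈-points []      = here refl
∈-points (a ∷ x) = ∈-cartesianProductWith⁺ _∷_ (∈-allFin a) (∈-points x)

length-points : ∀ p n → length (points p n) ≡ p ^ n
length-points p zero    = refl
length-points p (suc n) = trans (go (allFin p))
  (cong₂ ℕ._*_ (length-tabulate {n = p} (λ i → i)) (length-points p n))
  where
  go : ∀ as → length (cartesianProductWith Vec._∷_ as (points p n)) ≡ length as ℕ.* length (points p n)
  go []       = refl
  go (a ∷ as) = trans (length-++ (map (a Vec.∷_) (points p n)))
                      (cong₂ ℕ._+_ (length-map (a Vec.∷_) (points p n)) (go as))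

-- Subsets of the finite set 𝔽^ p n are given by their characteristic functions.
𝒫 : ℕ → ℕ → Set
𝒫 p n = 𝔽^ p n → Bool

card : ∀ {p n} → 𝒫 p n → ℕ
card {p} {n} A = length (filterᵇ A (points p n))

𝟏 : ∀ {p n} → 𝒫 p n → 𝔽^ p n → ℚ
𝟏 A x = if A x then 1ℚ else 0ℚ

module _ {p n : ℕ} .{{_ : NonZero p}} where

  density : 𝒫 p n → ℚ
  density A = _/_ (+ card A) (p ^ n) {{m^n≢0 p n}}

  𝔼 : (𝔽^ p n → ℚ) → ℚ
  𝔼 f = _/_ (+ 1) (p ^ n) {{m^n≢0 p n}} * foldr _+_ 0ℚ (map f (points p n))

  -- Indicator functions are rational-valued, so ℚ stands in for ℝ here.
  I₃ : (𝔽^ p n → ℚ) → 𝔽^ p n → ℚ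
  I₃ f d = 𝔼 λ x → f x * f (x ⊕ d) * f (x ⊕ 2 · d)

  -- m = max { g d : d ≠ 0 }; in particular some d ≠ 0 exists.
  IsMaxOverNonzero : (𝔽^ p n → ℚ) → ℚ → Set
  IsMaxOverNonzero g m = (∃[ d ] d ≢ 𝟎 × g d ≡ m) × (∀ d → d ≢ 𝟎 → g d ≤ m)

infix 4 _⟶_

_⟶_ : (ℕ → ℚ) → ℚ → Set
a ⟶ l = ∀ ε → 0ℚ < ε → ∃[ N ] (∀ n → N ℕ.≤ n → ∣ a n - l ∣ < ε)

{-# OPTIONS --safe #-}

-- Let Q be the sum of the squares of the coordinates and A = { x : Q x mod p ∈ S } with S ⊆ ℤ/p.
-- Since Q x - 2 Q (x + d) + Q (x + 2 d) = 2 Q d and, for d ≠ 0, the pair (Q x , Q (x + d)) is nearly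
-- equidistributed modulo p (by a second moment computation: two points x and x + h collide only if
-- two linear conditions hold), I₃ (1_A) d is close to the density of the solutions of
-- a - 2 b + c = 2 Q d in S. Passing from d to 2 d multiplies the right-hand side s by 4. So it
-- suffices to find S of density 1/2 with noticeably fewer solutions than a random set unless s / p
-- is close to 1/2: if s / p is close to 1/2, then 4 s / p is close to 0. Such an S is a union of
-- intervals of length about p / 360, one for each element of an explicit set 𝕁 ⊆ ℤ/360 with 180
-- elements, and the counting reduces to a finite verification for 𝕁. Passing to subsets only
-- decreases I₃, so S is taken slightly too large and A is trimmed to ⌊p ^ n / 2⌋ points.

module Submission where

open import Defs

-- The obstacle is that `p` is not a multiple of 360. With p = 360 L + r, reduction modulo p and
-- modulo 360 L differ by small multiples of r; short gaps in the intervals absorb them. For fixed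
-- offsets inside the intervals, the block of the third term of a progression is then determined
-- modulo 360 by the first two blocks and a carry between 0 and 4, so that progressions are counted
-- by the finite quantity `N`. The excluded range of s / p is the interval (2/5, 3/5):
-- multiplication by 4 exchanges its end points modulo 1, and it is the largest interval centred at
-- 1/2 that is disjoint from its image. In blocks this is 144 to 216, rounded to 145 and 216 because
-- of the incomplete last block. The verified bound is 16184 out of 360², against 16200 for density
-- 1/2. One unit pays for all error terms, and the remaining 15 / 360² is the constant 1 / 8640.
-- Everything is counted in natural numbers, with subtracted terms moved to the other side, and is
-- divided by p ^ n only at the end.

module Counting where

  open import Algebra.Properties.CommutativeSemigroup using (interchange; x∙yz≈y∙xz)
  open import Data.Bool.Base using (Bool; true; false; not; _∧_; _∨_; T)
  open import Data.Bool.Properties using (T-∧; T-≡)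
  open import Data.Fin.Base as Fin using (Fin; toℕ)
  import Data.Fin.Properties as Fin
  open import Data.Fin.Properties using (toℕ<n; toℕ-fromℕ<; toℕ-injective)
  open import Data.List.Base using (List; []; _∷_; _++_; map; length; filterᵇ; allFin; tabulate; upTo; applyUpTo; drop; cartesianProductWith)
  open import Data.List.Relation.Unary.All as All using (All; []; _∷_)
  open import Data.List.Relation.Unary.AllPairs using ([]; _∷_)
  open import Data.List.Relation.Unary.Unique.Propositional using (Unique)
  open import Data.List.Relation.Unary.Unique.Propositional.Properties using (cartesianProductWith⁺; allFin⁺)
  open import Data.Nat.Base
  open import Data.Nat.DivMod
  open import Data.Nat.Divisibility using (n∣m*n; m%n≡0⇒n∣m; n∣m⇒m%n≡0; >⇒∤)
  open import Data.Nat.Primality using (Prime; euclidsLemma)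
  open import Data.Nat.Properties
  open import Data.Nat.Tactic.RingSolver using (solve-∀)
  open import Data.Product.Base using (Σ-syntax; _×_; _,_; proj₁; proj₂)
  open import Data.Sum.Base using (_⊎_; inj₁; inj₂)
  open import Data.Vec.Base using ([]; _∷_)
  open import Data.Vec.Properties using (≡-dec; ∷-injective; zipWith-comm)
  open import Function.Base using (id; _∘_)
  open import Function.Bundles using (module Equivalence)
  open import Relation.Binary.Definitions using (DecidableEquality)
  open import Relation.Binary.PropositionalEquality
  open import Relation.Nullary using (Dec; yes; no; does; contradiction)

  private variable
    X Y Z : Set

  -- Finite sums

  ∑ : List X → (X → ℕ) → ℕ
  ∑ []       f = 0
  ∑ (x ∷ xs) f = f x + ∑ xs f

  syntax ∑ xs (λ x → e) = ∑[ x ← xs ] e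

  infix 8 ∑

  ⟦_⟧ : Bool → ℕ
  ⟦ true  ⟧ = 1
  ⟦ false ⟧ = 0

  ⟦⟧≤1 : ∀ b → ⟦ b ⟧ ≤ 1
  ⟦⟧≤1 true  = ≤-refl
  ⟦⟧≤1 false = z≤n

  ∑-cong : (xs : List X) {f g : X → ℕ} → (∀ x → f x ≡ g x) → ∑ xs f ≡ ∑ xs g
  ∑-cong []       h = refl
  ∑-cong (x ∷ xs) h = cong₂ _+_ (h x) (∑-cong xs h)

  ∑-mono : (xs : List X) {f g : X → ℕ} → (∀ x → f x ≤ g x) → ∑ xs f ≤ ∑ xs g
  ∑-mono []       h = z≤n
  ∑-mono (x ∷ xs) h = +-mono-≤ (h x) (∑-mono xs h)

  ∑-zero : (xs : List X) → ∑[ _ ← xs ] 0 ≡ 0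
  ∑-zero []       = refl
  ∑-zero (x ∷ xs) = ∑-zero xs

  ∑-+ : (xs : List X) (f g : X → ℕ) → ∑[ x ← xs ] (f x + g x) ≡ ∑ xs f + ∑ xs g
  ∑-+ []       f g = refl
  ∑-+ (x ∷ xs) f g = trans (cong (f x + g x +_) (∑-+ xs f g)) (interchange +-commutativeSemigroup (f x) (g x) _ _)

  ∑-*ˡ : (xs : List X) (k : ℕ) (f : X → ℕ) → ∑[ x ← xs ] (k * f x) ≡ k * ∑ xs f
  ∑-*ˡ []       k f = sym (*-zeroʳ k)
  ∑-*ˡ (x ∷ xs) k f = trans (cong (k * f x +_) (∑-*ˡ xs k f)) (sym (*-distribˡ-+ k (f x) _))

  ∑-*ʳ : (xs : List X) (f : X → ℕ) (k : ℕ) → ∑[ x ← xs ] (f x * k) ≡ ∑ xs f * k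
  ∑-*ʳ xs f k = trans (∑-cong xs λ x → *-comm (f x) k) (trans (∑-*ˡ xs k f) (*-comm k _))

  ∑-const : (xs : List X) (k : ℕ) → ∑[ _ ← xs ] k ≡ length xs * k
  ∑-const []       k = refl
  ∑-const (x ∷ xs) k = cong (k +_) (∑-const xs k)

  ∑-swap : (xs : List X) (ys : List Y) (f : X → Y → ℕ) →
    ∑[ x ← xs ] ∑[ y ← ys ] f x y ≡ ∑[ y ← ys ] ∑[ x ← xs ] f x y
  ∑-swap []       ys f = sym (∑-zero ys)
  ∑-swap (x ∷ xs) ys f = trans (cong (∑ ys (f x) +_) (∑-swap xs ys f))
                               (sym (∑-+ ys (f x) (λ y → ∑[ x ← xs ] f x y)))

  ∑-++ : (xs ys : List X) (f : X → ℕ) → ∑ (xs ++ ys) f ≡ ∑ xs f + ∑ ys f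
  ∑-++ []       ys f = refl
  ∑-++ (x ∷ xs) ys f = trans (cong (f x +_) (∑-++ xs ys f)) (sym (+-assoc (f x) _ _))

  ∑-map : (g : X → Y) (xs : List X) (f : Y → ℕ) → ∑ (map g xs) f ≡ ∑ xs (f ∘ g)
  ∑-map g []       f = refl
  ∑-map g (x ∷ xs) f = cong (f (g x) +_) (∑-map g xs f)

  ∑-cartesianProductWith : (h : X → Y → Z) (xs : List X) (ys : List Y) (f : Z → ℕ) →
    ∑ (cartesianProductWith h xs ys) f ≡ ∑[ x ← xs ] ∑[ y ← ys ] f (h x y)
  ∑-cartesianProductWith h []       ys f = refl
  ∑-cartesianProductWith h (x ∷ xs) ys f =
    trans (∑-++ (map (h x) ys) _ f)
          (cong₂ _+_ (∑-map (h x) ys f) (∑-cartesianProductWith h xs ys f))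

  ∑-points : ∀ p n (f : 𝔽^ p (suc n) → ℕ) →
    ∑ (points p (suc n)) f ≡ ∑[ a ← allFin p ] ∑[ x ← points p n ] f (a ∷ x)
  ∑-points p n = ∑-cartesianProductWith _∷_ (allFin p) (points p n)

  length-filterᵇ : (A : X → Bool) (xs : List X) → length (filterᵇ A xs) ≡ ∑[ x ← xs ] ⟦ A x ⟧
  length-filterᵇ A []       = refl
  length-filterᵇ A (x ∷ xs) with A x
  ... | true  = cong suc (length-filterᵇ A xs)
  ... | false = length-filterᵇ A xs

  ⟦not⟧ : ∀ b → ⟦ b ⟧ + ⟦ not b ⟧ ≡ 1
  ⟦not⟧ true  = refl
  ⟦not⟧ false = refl

  ∑-not : (A : X → Bool) (xs : List X) → ∑[ x ← xs ] ⟦ A x ⟧ + ∑[ x ← xs ] ⟦ not (A x) ⟧ ≡ length xs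
  ∑-not A xs = trans (sym (∑-+ xs _ _)) (trans (∑-cong xs λ x → ⟦not⟧ (A x))
               (trans (∑-const xs 1) (*-identityʳ _)))

  -- Sums over ranges of numbers

  ∑-applyUpTo : ∀ (g : ℕ → X) n (f : X → ℕ) → ∑ (applyUpTo g n) f ≡ ∑ (upTo n) (f ∘ g)
  ∑-applyUpTo g zero    f = refl
  ∑-applyUpTo g (suc n) f = cong (f (g 0) +_)
    (trans (∑-applyUpTo (g ∘ suc) n f) (sym (∑-applyUpTo suc n (f ∘ g))))

  ∑-upTo-suc : ∀ n f → ∑ (upTo (suc n)) f ≡ f 0 + ∑ (upTo n) (f ∘ suc)
  ∑-upTo-suc n f = cong (f 0 +_) (∑-applyUpTo suc n f)

  ∑-tabulate : ∀ {n} (g : Fin n → X) (f : X → ℕ) (k : ℕ → ℕ) → (∀ i → f (g i) ≡ k (toℕ i)) →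
    ∑ (tabulate g) f ≡ ∑ (upTo n) k
  ∑-tabulate {n = zero}  g f k h = refl
  ∑-tabulate {n = suc n} g f k h = trans
    (cong₂ _+_ (h Fin.zero) (∑-tabulate (g ∘ Fin.suc) f (k ∘ suc) (λ i → h (Fin.suc i))))
    (sym (∑-upTo-suc n k))

  ∑-allFin : ∀ n (k : ℕ → ℕ) → ∑[ a ← allFin n ] k (toℕ a) ≡ ∑ (upTo n) k
  ∑-allFin n k = ∑-tabulate {n = n} id (k ∘ toℕ) k (λ _ → refl)

  ∑-upTo-cong : ∀ n {f g : ℕ → ℕ} → (∀ i → i < n → f i ≡ g i) → ∑ (upTo n) f ≡ ∑ (upTo n) g
  ∑-upTo-cong zero    h = refl
  ∑-upTo-cong (suc n) {f} {g} h = begin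
    ∑ (upTo (suc n)) f           ≡⟨ ∑-upTo-suc n f ⟩
    f 0 + ∑ (upTo n) (f ∘ suc)   ≡⟨ cong₂ _+_ (h 0 z<s) (∑-upTo-cong n λ i i<n → h (suc i) (s<s i<n)) ⟩
    g 0 + ∑ (upTo n) (g ∘ suc)   ≡⟨ ∑-upTo-suc n g ⟨
    ∑ (upTo (suc n)) g           ∎
    where open ≡-Reasoning

  ∑-upTo-mono : ∀ n {f g : ℕ → ℕ} → (∀ i → i < n → f i ≤ g i) → ∑ (upTo n) f ≤ ∑ (upTo n) g
  ∑-upTo-mono zero    h = z≤n
  ∑-upTo-mono (suc n) {f} {g} h = begin
    ∑ (upTo (suc n)) f           ≡⟨ ∑-upTo-suc n f ⟩
    f 0 + ∑ (upTo n) (f ∘ suc)   ≤⟨ +-mono-≤ (h 0 z<s) (∑-upTo-mono n λ i i<n → h (suc i) (s<s i<n)) ⟩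
    g 0 + ∑ (upTo n) (g ∘ suc)   ≡⟨ ∑-upTo-suc n g ⟨
    ∑ (upTo (suc n)) g           ∎
    where open ≤-Reasoning

  ∑-upTo-const : ∀ n k → ∑[ _ ← upTo n ] k ≡ n * k
  ∑-upTo-const zero    k = refl
  ∑-upTo-const (suc n) k = trans (∑-upTo-suc n _) (cong (k +_) (∑-upTo-const n k))

  ∑-upTo-+ : ∀ m n f → ∑ (upTo (m + n)) f ≡ ∑ (upTo m) f + ∑[ i ← upTo n ] f (m + i)
  ∑-upTo-+ zero    n f = refl
  ∑-upTo-+ (suc m) n f = begin
    ∑ (upTo (suc m + n)) f                                             ≡⟨ ∑-upTo-suc (m + n) f ⟩
    f 0 + ∑ (upTo (m + n)) (f ∘ suc)                                   ≡⟨ cong (f 0 +_) (∑-upTo-+ m n (f ∘ suc)) ⟩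
    f 0 + (∑ (upTo m) (f ∘ suc) + ∑[ i ← upTo n ] f (suc m + i))       ≡⟨ +-assoc (f 0) _ _ ⟨
    f 0 + ∑ (upTo m) (f ∘ suc) + ∑[ i ← upTo n ] f (suc m + i)         ≡⟨ cong₂ _+_ (∑-upTo-suc m f) refl ⟨
    ∑ (upTo (suc m)) f + ∑[ i ← upTo n ] f (suc m + i)                 ∎
    where open ≡-Reasoning

  ∑-upTo-* : ∀ m l f → ∑ (upTo (m * l)) f ≡ ∑[ i ← upTo m ] ∑[ j ← upTo l ] f (i * l + j)
  ∑-upTo-* zero    l f = refl
  ∑-upTo-* (suc m) l f = begin
    ∑ (upTo (l + m * l)) f
      ≡⟨ ∑-upTo-+ l (m * l) f ⟩
    ∑ (upTo l) f + ∑[ i ← upTo (m * l) ] f (l + i)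
      ≡⟨ cong (∑ (upTo l) f +_) (∑-upTo-* m l (f ∘ (l +_))) ⟩
    ∑ (upTo l) f + ∑[ i ← upTo m ] ∑[ j ← upTo l ] f (l + (i * l + j))
      ≡⟨ cong (∑ (upTo l) f +_) (∑-cong (upTo m) λ i → ∑-cong (upTo l) λ j → cong f (sym (+-assoc l (i * l) j))) ⟩
    ∑ (upTo l) f + ∑[ i ← upTo m ] ∑[ j ← upTo l ] f (suc i * l + j)
      ≡⟨ ∑-upTo-suc m (λ i → ∑[ j ← upTo l ] f (i * l + j)) ⟨
    ∑[ i ← upTo (suc m) ] ∑[ j ← upTo l ] f (i * l + j) ∎
    where open ≡-Reasoning

  ∑-upTo-∷ʳ : ∀ n f → ∑ (upTo (suc n)) f ≡ ∑ (upTo n) f + f n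
  ∑-upTo-∷ʳ n f = begin
    ∑ (upTo (suc n)) f             ≡⟨ cong (λ m → ∑ (upTo m) f) (+-comm 1 n) ⟩
    ∑ (upTo (n + 1)) f             ≡⟨ ∑-upTo-+ n 1 f ⟩
    ∑ (upTo n) f + (f (n + 0) + 0) ≡⟨ cong (∑ (upTo n) f +_) (trans (+-identityʳ _) (cong f (+-identityʳ n))) ⟩
    ∑ (upTo n) f + f n             ∎
    where open ≡-Reasoning

  -- Moving the window by one step drops `f m` and gains `f (m + n)`, which agree by periodicity.
  ∑-upTo-shift : ∀ n f → (∀ i → f (n + i) ≡ f i) → ∀ m → ∑[ i ← upTo n ] f (m + i) ≡ ∑ (upTo n) f
  ∑-upTo-shift n f per zero    = refl
  ∑-upTo-shift n f per (suc m) = begin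
    ∑[ i ← upTo n ] f (suc m + i)             ≡⟨ ∑-cong (upTo n) (λ i → cong f (sym (+-suc m i))) ⟩
    ∑[ i ← upTo n ] f (m + suc i)             ≡⟨ +-cancelʳ-≡ (f (m + 0)) _ _ rotate ⟩
    ∑[ i ← upTo n ] f (m + i)                 ≡⟨ ∑-upTo-shift n f per m ⟩
    ∑ (upTo n) f                              ∎
    where
    open ≡-Reasoning
    wrap : f (m + n) ≡ f (m + 0)
    wrap = trans (cong f (+-comm m n)) (trans (per m) (cong f (sym (+-identityʳ m))))
    rotate : ∑[ i ← upTo n ] f (m + suc i) + f (m + 0) ≡ ∑[ i ← upTo n ] f (m + i) + f (m + 0)
    rotate = begin
      ∑[ i ← upTo n ] f (m + suc i) + f (m + 0) ≡⟨ +-comm _ (f (m + 0)) ⟩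
      f (m + 0) + ∑[ i ← upTo n ] f (m + suc i) ≡⟨ ∑-upTo-suc n (λ i → f (m + i)) ⟨
      ∑[ i ← upTo (suc n) ] f (m + i)           ≡⟨ ∑-upTo-∷ʳ n (λ i → f (m + i)) ⟩
      ∑[ i ← upTo n ] f (m + i) + f (m + n)     ≡⟨ cong₂ _+_ refl wrap ⟩
      ∑[ i ← upTo n ] f (m + i) + f (m + 0)     ∎

  ∑-upTo-at-most-one : ∀ n (f : ℕ → Bool) →
    (∀ i j → i < n → j < n → f i ≡ true → f j ≡ true → i ≡ j) → ∑[ i ← upTo n ] ⟦ f i ⟧ ≤ 1
  ∑-upTo-at-most-one zero    f inj = z≤n
  ∑-upTo-at-most-one (suc n) f inj with f 0 in f0
  ... | false = ≤-trans (≤-reflexive (trans (∑-applyUpTo suc n _) refl))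
                  (∑-upTo-at-most-one n (f ∘ suc) λ i j i<n j<n fi fj →
                     suc-injective (inj (suc i) (suc j) (s<s i<n) (s<s j<n) fi fj))
  ... | true = ≤-reflexive (cong suc (trans (∑-applyUpTo suc n _) (trans (∑-upTo-cong n vanish) (∑-zero (upTo n)))))
    where
    vanish : ∀ i → i < n → ⟦ f (suc i) ⟧ ≡ 0
    vanish i i<n with f (suc i) in fi
    ... | false = refl
    ... | true with () ← inj 0 (suc i) z<s (s<s i<n) f0 fi

  ∑-upTo-≡ᵇ : ∀ n a → a < n → (g : ℕ → ℕ) → ∑[ i ← upTo n ] (⟦ a ≡ᵇ i ⟧ * g i) ≡ g a
  ∑-upTo-≡ᵇ (suc n) zero    a<n g = begin
    ∑[ i ← upTo (suc n) ] (⟦ 0 ≡ᵇ i ⟧ * g i) ≡⟨ ∑-upTo-suc n _ ⟩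
    g 0 + 0 + ∑[ i ← upTo n ] 0               ≡⟨ cong₂ _+_ (+-identityʳ (g 0)) (∑-zero (upTo n)) ⟩
    g 0 + 0                                   ≡⟨ +-identityʳ (g 0) ⟩
    g 0                                       ∎
    where open ≡-Reasoning
  ∑-upTo-≡ᵇ (suc n) (suc a) a<n g = trans (∑-upTo-suc n (λ i → ⟦ suc a ≡ᵇ i ⟧ * g i)) (∑-upTo-≡ᵇ n a (s<s⁻¹ a<n) (g ∘ suc))

  -- A finite convolution count

  infix 8 _∙_ _∙₂_

  _∙_ : List ℕ → List ℕ → ℕ
  (x ∷ xs) ∙ (y ∷ ys) = x * y + xs ∙ ys
  _        ∙ _        = 0

  -- Reading the second list at even positions only produces the coefficient 2 of `j` in `N`.
  _∙₂_ : List ℕ → List ℕ → ℕ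
  (x ∷ xs) ∙₂ (y ∷ _ ∷ ys) = x * y + xs ∙₂ ys
  _        ∙₂ _            = 0

  ∙-applyUpTo : ∀ (f g : ℕ → ℕ) m n → m ≤ n →
    applyUpTo f m ∙ applyUpTo g n ≡ ∑[ i ← upTo m ] (f i * g i)
  ∙-applyUpTo f g zero    n       _   = refl
  ∙-applyUpTo f g (suc m) (suc n) m≤n = trans (cong (f 0 * g 0 +_) (∙-applyUpTo (f ∘ suc) (g ∘ suc) m n (s≤s⁻¹ m≤n)))
                                              (sym (∑-upTo-suc m (λ i → f i * g i)))

  ∙₂-applyUpTo : ∀ (f g : ℕ → ℕ) m n → 2 * m ≤ n →
    applyUpTo f m ∙₂ applyUpTo g n ≡ ∑[ i ← upTo m ] (f i * g (2 * i))
  ∙₂-applyUpTo f g zero    n             _ = refl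
  ∙₂-applyUpTo f g (suc m) (suc zero)    h with s≤s () ← subst (_≤ 1) (*-suc 2 m) h
  ∙₂-applyUpTo f g (suc m) (suc (suc n)) h = begin
    f 0 * g 0 + applyUpTo (f ∘ suc) m ∙₂ applyUpTo (g ∘ suc ∘ suc) n
      ≡⟨ cong (f 0 * g 0 +_) (∙₂-applyUpTo (f ∘ suc) (g ∘ suc ∘ suc) m n (s≤s⁻¹ (s≤s⁻¹ (subst (_≤ 2 + n) (*-suc 2 m) h)))) ⟩
    f 0 * g 0 + ∑[ i ← upTo m ] (f (suc i) * g (2 + 2 * i))
      ≡⟨ cong (f 0 * g 0 +_) (∑-cong (upTo m) λ i → cong (λ z → f (suc i) * g z) (sym (*-suc 2 i))) ⟩
    f 0 * g 0 + ∑[ i ← upTo m ] (f (suc i) * g (2 * suc i))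
      ≡⟨ ∑-upTo-suc m (λ i → f i * g (2 * i)) ⟨
    ∑[ i ← upTo (suc m) ] (f i * g (2 * i)) ∎
    where open ≡-Reasoning

  drop-applyUpTo : ∀ (f : ℕ → ℕ) k n → drop k (applyUpTo f n) ≡ applyUpTo (λ i → f (k + i)) (n ∸ k)
  drop-applyUpTo f zero    n       = refl
  drop-applyUpTo f (suc k) zero    = refl
  drop-applyUpTo f (suc k) (suc n) = drop-applyUpTo (f ∘ suc) k n

  ∙-drop : ∀ (f g : ℕ → ℕ) k m n → k + m ≤ n →
    applyUpTo f m ∙ drop k (applyUpTo g n) ≡ ∑[ i ← upTo m ] (f i * g (k + i))
  ∙-drop f g k m n h = trans (cong (applyUpTo f m ∙_) (drop-applyUpTo g k n))
    (∙-applyUpTo f (λ i → g (k + i)) m (n ∸ k) (m+n≤o⇒m≤o∸n m (subst (_≤ n) (+-comm k m) h)))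

  ∙₂-drop : ∀ (f g : ℕ → ℕ) k m n → k + 2 * m ≤ n →
    applyUpTo f m ∙₂ drop k (applyUpTo g n) ≡ ∑[ i ← upTo m ] (f i * g (k + 2 * i))
  ∙₂-drop f g k m n h = trans (cong (applyUpTo f m ∙₂_) (drop-applyUpTo g k n))
    (∙₂-applyUpTo f (λ i → g (k + i)) m (n ∸ k) (m+n≤o⇒m≤o∸n (2 * m) (subst (_≤ n) (+-comm k (2 * m)) h)))

  allFrom : (ℕ → Bool) → ℕ → ℕ → Bool
  allFrom P m zero    = true
  allFrom P m (suc n) = P m ∧ allFrom P (suc m) n

  allFrom⇒ : ∀ (P : ℕ → Bool) m n → T (allFrom P m n) → ∀ k → k < n → T (P (m + k))
  allFrom⇒ P m (suc n) h zero    k<n = subst (T ∘ P) (sym (+-identityʳ m)) (proj₁ (Equivalence.to T-∧ h))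
  allFrom⇒ P m (suc n) h (suc k) k<n = subst (T ∘ P) (sym (+-suc m k))
    (allFrom⇒ P (suc m) n (proj₂ (Equivalence.to (T-∧ {P m}) h)) k (s<s⁻¹ k<n))

  module Convolution (h : ℕ) (𝕁 : ℕ → Bool) where

    M : ℕ
    M = suc h

    -- R y counts the i, k ∈ 𝕁 with i + k ≡ y - 1 modulo M, and N w counts the solutions of
    -- i + k ≡ 2 j + w - 1.
    R : ℕ → ℕ
    R y = ∑[ i ← upTo M ] (⟦ 𝕁 i ⟧ * ⟦ 𝕁 ((y % M + (h ∸ i)) % M) ⟧)

    N : ℕ → ℕ
    N w = ∑[ j ← upTo M ] (⟦ 𝕁 j ⟧ * R (2 * j + w))

    -- R and N are evaluated through shared tables of 𝕁, of its reflection and of R, because the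
    -- sums themselves are too slow to normalise.
    table : List ℕ
    table = applyUpTo (λ i → ⟦ 𝕁 i ⟧) M

    -- Entry `m` is 𝕁 at `h - m` modulo `M`, so `R y` is the product of `table` with the suffix that
    -- starts at `M ∸ y % M`. Two periods make each of these suffixes long enough.
    reflected : List ℕ
    reflected = applyUpTo (λ m → ⟦ 𝕁 ((h + M ∸ m) % M) ⟧) (M + M)

    R-from : List ℕ → List ℕ → ℕ → ℕ
    R-from js ks y = js ∙ drop (M ∸ y % M) ks

    N-from : List ℕ → List ℕ → ℕ → ℕ
    N-from js rs w = js ∙₂ drop w rs

    R-from≡R : ∀ y → R-from table reflected y ≡ R y
    R-from≡R y = trans
      (∙-drop (λ i → ⟦ 𝕁 i ⟧) (λ m → ⟦ 𝕁 ((h + M ∸ m) % M) ⟧) (M ∸ z) M (M + M) (+-monoˡ-≤ M (m∸n≤m M z)))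
      (∑-upTo-cong M (λ i i<M → cong (λ k → ⟦ 𝕁 i ⟧ * ⟦ 𝕁 (k % M) ⟧) (reflect i i<M)))
      where
      z = y % M
      reflect : ∀ i → i < M → h + M ∸ (M ∸ z + i) ≡ z + (h ∸ i)
      reflect i i<M = begin
        h + M ∸ (M ∸ z + i)     ≡⟨ ∸-+-assoc (h + M) (M ∸ z) i ⟨
        h + M ∸ (M ∸ z) ∸ i     ≡⟨ cong (_∸ i) (+-∸-assoc h (m∸n≤m M z)) ⟩
        h + (M ∸ (M ∸ z)) ∸ i   ≡⟨ cong (λ k → h + k ∸ i) (m∸[m∸n]≡n (<⇒≤ (m%n<n y M))) ⟩
        h + z ∸ i               ≡⟨ cong (_∸ i) (+-comm h z) ⟩
        z + h ∸ i               ≡⟨ +-∸-assoc z (s≤s⁻¹ i<M) ⟩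
        z + (h ∸ i)             ∎
        where open ≡-Reasoning

    N-from≡N : ∀ w l → w + 2 * M ≤ l → N-from table (applyUpTo (R-from table reflected) l) w ≡ N w
    N-from≡N w l w≤ = trans
      (∙₂-drop (λ i → ⟦ 𝕁 i ⟧) (R-from table reflected) w M l w≤)
      (∑-cong (upTo M) λ j → cong (⟦ 𝕁 j ⟧ *_) (trans (R-from≡R (w + 2 * j)) (cong R (+-comm w (2 * j)))))

    bounded : ℕ → ℕ → ℕ → List ℕ → List ℕ → Bool
    bounded C m n js rs = allFrom (λ w → N-from js rs w ≤ᵇ C) m n

    bounded⇒ : ∀ C m n l → T (bounded C m n table (applyUpTo (R-from table reflected) l)) →
      m + n + 2 * M ≤ suc l → ∀ w → m ≤ w → w < m + n → N w ≤ C
    bounded⇒ C m n l ok fits w m≤w w<m+n = subst (_≤ C)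
      (N-from≡N w l (s≤s⁻¹ (≤-trans (+-monoˡ-≤ (2 * M) w<m+n) fits)))
      (≤ᵇ⇒≤ _ C (subst (T ∘ P) (m+[n∸m]≡n m≤w)
        (allFrom⇒ P m n ok (w ∸ m) (+-cancelˡ-< m _ n (subst (_< m + n) (sym (m+[n∸m]≡n m≤w)) w<m+n)))))
      where
      P : ℕ → Bool
      P w = N-from table (applyUpTo (R-from table reflected) l) w ≤ᵇ C

    check-table : (C a b c : ℕ) → List ℕ → List ℕ → Bool
    check-table C a b c js rs = bounded C 0 a js rs ∧ bounded C b c js rs

    check : (C a b c l : ℕ) → List ℕ → List ℕ → Bool
    check C a b c l js ks = check-table C a b c js (applyUpTo (R-from js ks) l)

    check⇒ : ∀ C a b c l → T (check C a b c l table reflected) → a + 2 * M ≤ suc l → b + c + 2 * M ≤ suc l →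
      ∀ w → w < a ⊎ (b ≤ w × w < b + c) → N w ≤ C
    check⇒ C a b c l ok fits₁ fits₂ w (inj₁ w<a) =
      bounded⇒ C 0 a l (proj₁ (Equivalence.to T-∧ ok)) fits₁ w z≤n w<a
    check⇒ C a b c l ok fits₁ fits₂ w (inj₂ (b≤w , w<b+c)) =
      bounded⇒ C b c l (proj₂ (Equivalence.to (T-∧ {bounded C 0 a table _}) ok)) fits₂ w b≤w w<b+c

  bit : ℕ → ℕ → Bool
  bit n zero    = n % 2 ≡ᵇ 1
  bit n (suc k) = bit (n / 2) k

  -- Found by simulated annealing. A random set of density 1/2 would have about 360² / 8 = 16200
  -- solutions for each w.
  𝕁 : ℕ → Bool
  𝕁 = bit 0xd920c000eeffe04ffbffdc85a79d8e1818c97bef3fff1e69c358709e0000014802110087a41f8002dffffe7ffc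

  -- The arguments that occur are `t + v` with a carry `v ≤ 4` and a block `t ≤ 360` outside the
  -- range from 145 to 215; hence the ends 149 = 145 + 4 and 365 = 360 + 5. The table of `R` needs
  -- 1084 = 364 + 2 · 360 entries, and the placeholder makes the type checker evaluate the test.
  N-bound : ∀ w → w < 149 ⊎ (216 ≤ w × w < 365) → Convolution.N 359 𝕁 w ≤ 16184
  N-bound = Convolution.check⇒ 359 𝕁 16184 149 216 149 1084 _ (m≤m+n 869 216) (m≤m+n 1085 0)

  ∑-𝕁 : ∑[ i ← upTo 360 ] ⟦ not (𝕁 i) ⟧ ≡ 180
  ∑-𝕁 = refl

  -- Division with remainder

  [k*n+m]/n≡k : ∀ k n m .{{_ : NonZero n}} → m < n → (k * n + m) / n ≡ k
  [k*n+m]/n≡k k n m m<n = begin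
    (k * n + m) / n       ≡⟨ +-distrib-/-∣ˡ m (n∣m*n k) ⟩
    k * n / n + m / n     ≡⟨ cong₂ _+_ (m*n/n≡m k n) (m<n⇒m/n≡0 m<n) ⟩
    k + 0                 ≡⟨ +-identityʳ k ⟩
    k                     ∎
    where open ≡-Reasoning

  [k*n+m]%n≡m : ∀ k n m .{{_ : NonZero n}} → m < n → (k * n + m) % n ≡ m
  [k*n+m]%n≡m k n m m<n = begin
    (k * n + m) % n   ≡⟨ cong (_% n) (+-comm (k * n) m) ⟩
    (m + k * n) % n   ≡⟨ [m+kn]%n≡m%n m k n ⟩
    m % n             ≡⟨ m<n⇒m%n≡m m<n ⟩
    m                 ∎
    where open ≡-Reasoning

  /-unique : ∀ k l n m m′ .{{_ : NonZero n}} → m < n → m′ < n → k * n + m ≡ l * n + m′ → k ≡ l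
  /-unique k l n m m′ m<n m′<n eq =
    trans (sym ([k*n+m]/n≡k k n m m<n)) (trans (cong (_/ n) eq) ([k*n+m]/n≡k l n m′ m′<n))

  T⟦⟧≤ : ∀ {b c} → (T b → T c) → ⟦ b ⟧ ≤ ⟦ c ⟧
  T⟦⟧≤ {false}         _ = z≤n
  T⟦⟧≤ {true}  {true}  _ = ≤-refl
  T⟦⟧≤ {true}  {false} f with () ← f _

  2L+L+L+L≡5L : ∀ L → 2 * L + L + L + L ≡ 5 * L
  2L+L+L+L≡5L = solve-∀
  2p+p+p≡4p : ∀ p → 2 * p + p + p ≡ 4 * p
  2p+p+p≡4p = solve-∀


  -- Progressions in a union of intervals modulo p

  module Blocks (h : ℕ) (𝕁 : ℕ → Bool) (L r : ℕ) .{{_ : NonZero L}} (r<L : r < L) where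

    open Convolution h 𝕁 using (M; R; N)

    p : ℕ
    p = M * L + r

    -- The gaps of length 3 r absorb the multiples e r, e ≤ 3, by which reduction modulo p differs
    -- from reduction modulo M L.
    S₀ : ℕ → Bool
    S₀ a = (a / L <ᵇ M) ∧ (𝕁 (a / L) ∧ (a % L + 3 * r <ᵇ L))

    S₀⇒ : ∀ a → T (S₀ a) → a / L < M × T (𝕁 (a / L)) × a % L + 3 * r < L
    S₀⇒ a s = let u , v = Equivalence.to T-∧ s ; v , w = Equivalence.to T-∧ v in <ᵇ⇒< _ _ u , v , <ᵇ⇒< _ _ w

    S₀-high : ∀ ρ → S₀ (M * L + ρ) ≡ false
    S₀-high ρ with S₀ (M * L + ρ) in eq
    ... | false = refl
    ... | true  with a/L<M , _ ← S₀⇒ (M * L + ρ) (subst T (sym eq) _) =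
      contradiction a/L<M (≤⇒≯ (≤-trans (≤-reflexive (sym (m*n/n≡m M L))) (/-monoˡ-≤ L (m≤m+n (M * L) ρ))))

    ∑-blocks : ∀ f → ∑ (upTo p) f ≡ ∑[ i ← upTo M ] ∑[ α ← upTo L ] f (i * L + α) + ∑[ ρ ← upTo r ] f (M * L + ρ)
    ∑-blocks f = trans (∑-upTo-+ (M * L) r f) (cong (_+ ∑[ ρ ← upTo r ] f (M * L + ρ)) (∑-upTo-* M L f))

    -- Only an upper bound is wanted, so the gap condition is dropped. The offset `α` becomes the
    -- outer variable because blocks are counted for fixed offsets.
    ∑-S₀ : ∀ (G : ℕ → ℕ) → ∑[ a ← upTo p ] (⟦ S₀ a ⟧ * G a) ≤ ∑[ α ← upTo L ] ∑[ i ← upTo M ] (⟦ 𝕁 i ⟧ * G (i * L + α))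
    ∑-S₀ G = begin
      ∑[ a ← upTo p ] (⟦ S₀ a ⟧ * G a)
        ≡⟨ ∑-blocks (λ a → ⟦ S₀ a ⟧ * G a) ⟩
      ∑[ i ← upTo M ] ∑[ α ← upTo L ] (⟦ S₀ (i * L + α) ⟧ * G (i * L + α)) + ∑[ ρ ← upTo r ] (⟦ S₀ (M * L + ρ) ⟧ * G (M * L + ρ))
        ≡⟨ cong₂ _+_ refl (trans (∑-cong (upTo r) λ ρ → cong (λ b → ⟦ b ⟧ * G (M * L + ρ)) (S₀-high ρ)) (∑-zero (upTo r))) ⟩
      ∑[ i ← upTo M ] ∑[ α ← upTo L ] (⟦ S₀ (i * L + α) ⟧ * G (i * L + α)) + 0
        ≡⟨ +-identityʳ _ ⟩
      ∑[ i ← upTo M ] ∑[ α ← upTo L ] (⟦ S₀ (i * L + α) ⟧ * G (i * L + α))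
        ≤⟨ ∑-mono (upTo M) (λ i → ∑-upTo-mono L λ α α<L → *-monoˡ-≤ (G (i * L + α)) (T⟦⟧≤ λ s →
             subst (T ∘ 𝕁) ([k*n+m]/n≡k i L α α<L) (proj₁ (proj₂ (S₀⇒ (i * L + α) s))))) ⟩
      ∑[ i ← upTo M ] ∑[ α ← upTo L ] (⟦ 𝕁 i ⟧ * G (i * L + α))
        ≡⟨ ∑-swap (upTo M) (upTo L) (λ i α → ⟦ 𝕁 i ⟧ * G (i * L + α)) ⟩
      ∑[ α ← upTo L ] ∑[ i ← upTo M ] (⟦ 𝕁 i ⟧ * G (i * L + α)) ∎
      where open ≤-Reasoning

    module _ .{{_ : NonZero p}} (s : ℕ) (s<p : s < p) where

      -- The third term of the progression a, b, c modulo p with a - 2 b + c = s.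
      third : ℕ → ℕ → ℕ
      third a b = (2 * b + s + (p ∸ a)) % p

      t σ : ℕ
      t = s / L
      σ = s % L

      -- The carry from the offsets into the block index. The summand `r` comes from the `p` that
      -- `third` adds before subtracting `a`; the `L` borrowed in `L ∸ α` is repaid by the offset 1
      -- in the definition of `R`.
      overflow : ℕ → ℕ → ℕ
      overflow α β = (2 * β + σ + r + (L ∸ α)) / L

      overflow≤4 : ∀ α β → β < L → overflow α β ≤ 4
      overflow≤4 α β β<L = s≤s⁻¹ (m<n*o⇒m/o<n {n = 5} (begin-strict
        2 * β + σ + r + (L ∸ α) <⟨ +-mono-<-≤ (+-mono-< (+-mono-≤-< (*-monoʳ-≤ 2 (<⇒≤ β<L)) (m%n<n s L)) r<L) (m∸n≤m L α) ⟩
        2 * L + L + L + L       ≡⟨ 2L+L+L+L≡5L L ⟩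
        5 * L                   ∎))
        where open ≤-Reasoning

      -- Compare the quotients by `L` of the two sides of 2 b + s + p = a + c + e p. Of e p = e M L
      -- + e r, the first part vanishes modulo `M` in the block index, and since e ≤ 3 the second
      -- part only moves `c` within the gap at the end of its own block. Hence the carry depends on
      -- `α` and `β` alone.
      block-of-third : ∀ {i j α β} → i < M → α < L → j < M → β < L → T (S₀ (third (i * L + α) (j * L + β))) →
        third (i * L + α) (j * L + β) / L ≡ ((2 * j + (t + overflow α β)) % M + (h ∸ i)) % M
      block-of-third {i} {j} {α} {β} i<M α<L j<M β<L c∈S = sym (begin
        (y % M + (h ∸ i)) % M   ≡⟨ %-distribˡ-+ (y % M) (h ∸ i) M ⟩
        (y % M % M + (h ∸ i) % M) % M ≡⟨ cong (λ z → (z + (h ∸ i) % M) % M) (m%n%n≡m%n y M) ⟩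
        (y % M + (h ∸ i) % M) % M ≡⟨ %-distribˡ-+ y (h ∸ i) M ⟨
        (y + (h ∸ i)) % M       ≡⟨ cong (_% M) (+-cancelʳ-≡ (suc i) _ _ shifted) ⟩
        (k + e * M) % M         ≡⟨ [m+kn]%n≡m%n k e M ⟩
        k % M                   ≡⟨ m<n⇒m%n≡m k<M ⟩
        k                       ∎)
        where
        open ≡-Reasoning
        a = i * L + α
        b = j * L + β
        x = 2 * b + s + (p ∸ a)
        c = x % p
        e = x / p
        k = c / L
        γ = c % L
        v = overflow α β
        τ = 2 * β + σ + r + (L ∸ α)
        y = 2 * j + (t + v)
        k<M = proj₁ (S₀⇒ c c∈S)
        γ+3r<L = proj₂ (proj₂ (S₀⇒ c c∈S))
        below : ∀ {i α} → i < M → α < L → i * L + α < p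
        below {i} {α} i<M α<L = ≤-trans (≤-trans (+-monoʳ-< (i * L) α<L) (≤-trans (≤-reflexive (+-comm (i * L) L)) (*-monoˡ-≤ L i<M))) (m≤m+n _ r)
        e≤3 : e ≤ 3
        e≤3 = s≤s⁻¹ (m<n*o⇒m/o<n {n = 4} (≤-trans (+-mono-<-≤ (+-mono-≤-< (*-monoʳ-≤ 2 (<⇒≤ (below j<M β<L))) s<p) (m∸n≤m p a))
              (≤-reflexive (2p+p+p≡4p p))))
        γ+er<L : γ + e * r < L
        γ+er<L = ≤-<-trans (+-monoʳ-≤ γ (*-monoˡ-≤ r e≤3)) γ+3r<L
        balance : 2 * b + s + p ≡ a + (c + e * p)
        balance = begin
          2 * b + s + p              ≡⟨ cong (2 * b + s +_) (m∸n+n≡m (<⇒≤ (below i<M α<L))) ⟨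
          2 * b + s + (p ∸ a + a)    ≡⟨ +-assoc (2 * b + s) (p ∸ a) a ⟨
          x + a                      ≡⟨ +-comm x a ⟩
          a + x                      ≡⟨ cong (a +_) (m≡m%n+[m/n]*n x p) ⟩
          a + (c + e * p)            ∎
        τ-split : 2 * β + σ + r + L ≡ α + (τ % L + v * L)
        τ-split = begin
          2 * β + σ + r + L               ≡⟨ cong (2 * β + σ + r +_) (m∸n+n≡m (<⇒≤ α<L)) ⟨
          2 * β + σ + r + (L ∸ α + α)     ≡⟨ +-assoc (2 * β + σ + r) (L ∸ α) α ⟨
          τ + α                           ≡⟨ +-comm τ α ⟩
          α + τ                           ≡⟨ cong (α +_) (m≡m%n+[m/n]*n τ L) ⟩
          α + (τ % L + v * L)             ∎
        in-blocks : (2 * j + t + M + v) * L + τ % L ≡ (1 + i + k + e * M) * L + (γ + e * r)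
        in-blocks = +-cancelˡ-≡ α _ _ (begin
          α + ((2 * j + t + M + v) * L + τ % L)                         ≡⟨ rearrange₁ α j t M v L (τ % L) ⟩
          (2 * j + t + M) * L + (α + (τ % L + v * L))                   ≡⟨ cong ((2 * j + t + M) * L +_) τ-split ⟨
          (2 * j + t + M) * L + (2 * β + σ + r + L)                     ≡⟨ rearrange₂ j t M L β σ r ⟩
          2 * (j * L + β) + (σ + t * L) + (M * L + r) + L               ≡⟨ cong (λ z → 2 * b + z + p + L) (m≡m%n+[m/n]*n s L) ⟨
          2 * b + s + p + L                                             ≡⟨ cong (_+ L) balance ⟩
          a + (c + e * p) + L                                           ≡⟨ cong (λ z → a + (z + e * p) + L) (m≡m%n+[m/n]*n c L) ⟩
          i * L + α + (γ + k * L + e * (M * L + r)) + L                 ≡⟨ rearrange₃ i L α γ k e M r ⟩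
          α + ((1 + i + k + e * M) * L + (γ + e * r))                   ∎)
          where
          rearrange₁ : ∀ α j t M v L ρ → α + ((2 * j + t + M + v) * L + ρ) ≡ (2 * j + t + M) * L + (α + (ρ + v * L))
          rearrange₁ = solve-∀
          rearrange₂ : ∀ j t M L β σ r → (2 * j + t + M) * L + (2 * β + σ + r + L) ≡ 2 * (j * L + β) + (σ + t * L) + (M * L + r) + L
          rearrange₂ = solve-∀
          rearrange₃ : ∀ i L α γ k e M r → i * L + α + (γ + k * L + e * (M * L + r)) + L ≡ α + ((1 + i + k + e * M) * L + (γ + e * r))
          rearrange₃ = solve-∀
        shifted : y + (h ∸ i) + suc i ≡ k + e * M + suc i
        shifted = begin
          y + (h ∸ i) + suc i       ≡⟨ +-assoc y (h ∸ i) (suc i) ⟩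
          y + (h ∸ i + suc i)       ≡⟨ cong (y +_) (trans (+-suc (h ∸ i) i) (cong suc (m∸n+n≡m (s≤s⁻¹ i<M)))) ⟩
          y + M                     ≡⟨ rearrange₁ j t v M ⟩
          2 * j + t + M + v         ≡⟨ /-unique _ _ L (τ % L) (γ + e * r) (m%n<n τ L) γ+er<L in-blocks ⟩
          1 + i + k + e * M         ≡⟨ rearrange₂ i k (e * M) ⟩
          k + e * M + suc i         ∎
          where
          rearrange₁ : ∀ j t v M → 2 * j + (t + v) + M ≡ 2 * j + t + M + v
          rearrange₁ = solve-∀
          rearrange₂ : ∀ i k z → 1 + i + k + z ≡ k + z + suc i
          rearrange₂ = solve-∀

      S₀-progressions : ℕ
      S₀-progressions = ∑[ a ← upTo p ] (⟦ S₀ a ⟧ * ∑[ b ← upTo p ] (⟦ S₀ b ⟧ * ⟦ S₀ (third a b) ⟧))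

      -- For each of the `L * L` pairs of offsets the carry is a constant `v`, and the admissible
      -- pairs of blocks are among those counted by `N (t + v)`.
      S₀-progressions≤ : ∀ C → (∀ v → v ≤ 4 → N (t + v) ≤ C) → S₀-progressions ≤ L * (L * C)
      S₀-progressions≤ C good = begin
        S₀-progressions
          ≤⟨ ∑-S₀ _ ⟩
        ∑[ α ← upTo L ] ∑[ i ← upTo M ] (⟦ 𝕁 i ⟧ * ∑[ b ← upTo p ] (⟦ S₀ b ⟧ * ⟦ S₀ (third (i * L + α) b) ⟧))
          ≤⟨ ∑-mono (upTo L) (λ α → ∑-mono (upTo M) λ i → *-monoʳ-≤ ⟦ 𝕁 i ⟧ (∑-S₀ (λ b → ⟦ S₀ (third (i * L + α) b) ⟧))) ⟩
        ∑[ α ← upTo L ] ∑[ i ← upTo M ] (⟦ 𝕁 i ⟧ * ∑[ β ← upTo L ] ∑[ j ← upTo M ] (⟦ 𝕁 j ⟧ * ⟦ S₀ (c i α j β) ⟧))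
          ≡⟨ ∑-cong (upTo L) (λ α → trans (∑-cong (upTo M) λ i → sym (∑-*ˡ (upTo L) ⟦ 𝕁 i ⟧ _)) (∑-swap (upTo M) (upTo L) _)) ⟩
        ∑[ α ← upTo L ] ∑[ β ← upTo L ] ∑[ i ← upTo M ] (⟦ 𝕁 i ⟧ * ∑[ j ← upTo M ] (⟦ 𝕁 j ⟧ * ⟦ S₀ (c i α j β) ⟧))
          ≤⟨ ∑-upTo-mono L (λ α α<L → ∑-upTo-mono L λ β β<L → in-block α<L β<L) ⟩
        ∑[ α ← upTo L ] ∑[ β ← upTo L ] C
          ≡⟨ trans (∑-cong (upTo L) λ _ → ∑-upTo-const L C) (∑-upTo-const L (L * C)) ⟩
        L * (L * C) ∎
        where
        open ≤-Reasoning
        c : ℕ → ℕ → ℕ → ℕ → ℕ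
        c i α j β = third (i * L + α) (j * L + β)
        in-block : ∀ {α β} → α < L → β < L → ∑[ i ← upTo M ] (⟦ 𝕁 i ⟧ * ∑[ j ← upTo M ] (⟦ 𝕁 j ⟧ * ⟦ S₀ (c i α j β) ⟧)) ≤ C
        in-block {α} {β} α<L β<L = begin
          ∑[ i ← upTo M ] (⟦ 𝕁 i ⟧ * ∑[ j ← upTo M ] (⟦ 𝕁 j ⟧ * ⟦ S₀ (c i α j β) ⟧))
            ≤⟨ ∑-upTo-mono M (λ i i<M → *-monoʳ-≤ ⟦ 𝕁 i ⟧ (∑-upTo-mono M λ j j<M → *-monoʳ-≤ ⟦ 𝕁 j ⟧ (T⟦⟧≤ λ c∈S →
                 subst (T ∘ 𝕁) (block-of-third i<M α<L j<M β<L c∈S) (proj₁ (proj₂ (S₀⇒ _ c∈S)))))) ⟩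
          ∑[ i ← upTo M ] (⟦ 𝕁 i ⟧ * ∑[ j ← upTo M ] (⟦ 𝕁 j ⟧ * K i j))
            ≡⟨ ∑-cong (upTo M) (λ i → sym (∑-*ˡ (upTo M) ⟦ 𝕁 i ⟧ _)) ⟩
          ∑[ i ← upTo M ] ∑[ j ← upTo M ] (⟦ 𝕁 i ⟧ * (⟦ 𝕁 j ⟧ * K i j))
            ≡⟨ ∑-swap (upTo M) (upTo M) _ ⟩
          ∑[ j ← upTo M ] ∑[ i ← upTo M ] (⟦ 𝕁 i ⟧ * (⟦ 𝕁 j ⟧ * K i j))
            ≡⟨ ∑-cong (upTo M) (λ j → trans (∑-cong (upTo M) λ i → x∙yz≈y∙xz *-commutativeSemigroup ⟦ 𝕁 i ⟧ ⟦ 𝕁 j ⟧ (K i j)) (∑-*ˡ (upTo M) ⟦ 𝕁 j ⟧ _)) ⟩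
          N (t + overflow α β)
            ≤⟨ good (overflow α β) (overflow≤4 α β β<L) ⟩
          C ∎
          where
          K : ℕ → ℕ → ℕ
          K i j = ⟦ 𝕁 (((2 * j + (t + overflow α β)) % M + (h ∸ i)) % M) ⟧

  -- Second moments

  2xy≤x²+y² : ∀ x y → 2 * (x * y) ≤ x * x + y * y
  2xy≤x²+y² x y with ≤-total x y
  ... | inj₁ x≤y with k , refl ← m≤n⇒∃[o]m+o≡n x≤y = m+n≤o⇒m≤o _ (≤-reflexive (expand x k))
    where
    expand : ∀ x k → 2 * (x * (x + k)) + k * k ≡ x * x + (x + k) * (x + k)
    expand = solve-∀
  ... | inj₂ y≤x with k , refl ← m≤n⇒∃[o]m+o≡n y≤x = m+n≤o⇒m≤o _ (≤-reflexive (expand y k))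
    where
    expand : ∀ y k → 2 * ((y + k) * y) + k * k ≡ (y + k) * (y + k) + y * y
    expand = solve-∀

  -- K f (n - e) ≤ K² + (n - e)², with both sides moved so that no subtraction occurs.
  deviation : ∀ K e n f → K * (⟦ f ⟧ * n) + 2 * (e * n) ≤ K * e * ⟦ f ⟧ + K * K + (n * n + e * e)
  deviation K e n false = begin
    K * 0 + 2 * (e * n)               ≡⟨ cong (_+ 2 * (e * n)) (*-zeroʳ K) ⟩
    2 * (e * n)                       ≤⟨ 2xy≤x²+y² e n ⟩
    e * e + n * n                     ≡⟨ +-comm (e * e) (n * n) ⟩
    n * n + e * e                     ≤⟨ m≤n+m _ (K * e * 0 + K * K) ⟩
    K * e * 0 + K * K + (n * n + e * e) ∎
    where open ≤-Reasoning
  deviation K e n true with ≤-total n e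
  ... | inj₁ n≤e = begin
    K * (1 * n) + 2 * (e * n)           ≤⟨ +-mono-≤ (*-monoʳ-≤ K (≤-trans (≤-reflexive (*-identityˡ n)) n≤e)) (2xy≤x²+y² e n) ⟩
    K * e + (e * e + n * n)             ≤⟨ m≤m+n _ (K * K) ⟩
    K * e + (e * e + n * n) + K * K     ≡⟨ rearrange K e n ⟩
    K * e * 1 + K * K + (n * n + e * e) ∎
    where
    open ≤-Reasoning
    rearrange : ∀ K e n → K * e + (e * e + n * n) + K * K ≡ K * e * 1 + K * K + (n * n + e * e)
    rearrange = solve-∀
  ... | inj₂ e≤n with k , refl ← m≤n⇒∃[o]m+o≡n e≤n = begin
    K * (1 * (e + k)) + 2 * (e * (e + k))                     ≡⟨ rearrange₁ K e k ⟩
    K * k + (K * e + 2 * (e * (e + k)))                       ≤⟨ +-monoˡ-≤ _ (≤-trans (m≤m+n (K * k) _) (2xy≤x²+y² K k)) ⟩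
    K * K + k * k + (K * e + 2 * (e * (e + k)))               ≡⟨ rearrange₂ K e k ⟩
    K * e * 1 + K * K + ((e + k) * (e + k) + e * e)           ∎
    where
    open ≤-Reasoning
    rearrange₁ : ∀ K e k → K * (1 * (e + k)) + 2 * (e * (e + k)) ≡ K * k + (K * e + 2 * (e * (e + k)))
    rearrange₁ = solve-∀
    rearrange₂ : ∀ K e k → K * K + k * k + (K * e + 2 * (e * (e + k))) ≡ K * e * 1 + K * K + ((e + k) * (e + k) + e * e)
    rearrange₂ = solve-∀

  module Moment {X : Set} (xs : List X) (p : ℕ) (u v : X → ℕ) (u<p : ∀ x → u x < p) (v<p : ∀ x → v x < p) where

    fibre : ℕ → ℕ → ℕ
    fibre a b = ∑[ x ← xs ] (⟦ u x ≡ᵇ a ⟧ * ⟦ v x ≡ᵇ b ⟧)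

    ∑∑ : (ℕ → ℕ → ℕ) → ℕ
    ∑∑ f = ∑[ a ← upTo p ] ∑[ b ← upTo p ] f a b

    ∑∑-+ : ∀ f g → ∑∑ (λ a b → f a b + g a b) ≡ ∑∑ f + ∑∑ g
    ∑∑-+ f g = trans (∑-cong (upTo p) λ a → ∑-+ (upTo p) (f a) (g a)) (∑-+ (upTo p) _ _)

    ∑∑-*ˡ : ∀ k f → ∑∑ (λ a b → k * f a b) ≡ k * ∑∑ f
    ∑∑-*ˡ k f = trans (∑-cong (upTo p) λ a → ∑-*ˡ (upTo p) k (f a)) (∑-*ˡ (upTo p) k _)

    ∑∑-const : ∀ k → ∑∑ (λ _ _ → k) ≡ p * (p * k)
    ∑∑-const k = trans (∑-cong (upTo p) λ _ → ∑-upTo-const p k) (∑-upTo-const p (p * k))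

    ∑-fibres : (g : ℕ → ℕ → ℕ) → ∑[ x ← xs ] g (u x) (v x) ≡ ∑∑ (λ a b → g a b * fibre a b)
    ∑-fibres g = begin
      ∑[ x ← xs ] g (u x) (v x)
        ≡⟨ ∑-cong xs (λ x → ∑-upTo-≡ᵇ p (u x) (u<p x) (λ a → g a (v x))) ⟨
      ∑[ x ← xs ] ∑[ a ← upTo p ] (⟦ u x ≡ᵇ a ⟧ * g a (v x))
        ≡⟨ ∑-cong xs (λ x → ∑-cong (upTo p) λ a → cong (⟦ u x ≡ᵇ a ⟧ *_) (∑-upTo-≡ᵇ p (v x) (v<p x) (g a))) ⟨
      ∑[ x ← xs ] ∑[ a ← upTo p ] (⟦ u x ≡ᵇ a ⟧ * ∑[ b ← upTo p ] (⟦ v x ≡ᵇ b ⟧ * g a b))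
        ≡⟨ ∑-swap xs (upTo p) _ ⟩
      ∑[ a ← upTo p ] ∑[ x ← xs ] (⟦ u x ≡ᵇ a ⟧ * ∑[ b ← upTo p ] (⟦ v x ≡ᵇ b ⟧ * g a b))
        ≡⟨ ∑-cong (upTo p) (λ a → ∑-cong xs λ x → ∑-*ˡ (upTo p) ⟦ u x ≡ᵇ a ⟧ _) ⟨
      ∑[ a ← upTo p ] ∑[ x ← xs ] ∑[ b ← upTo p ] (⟦ u x ≡ᵇ a ⟧ * (⟦ v x ≡ᵇ b ⟧ * g a b))
        ≡⟨ ∑-cong (upTo p) (λ a → ∑-swap xs (upTo p) _) ⟩
      ∑[ a ← upTo p ] ∑[ b ← upTo p ] ∑[ x ← xs ] (⟦ u x ≡ᵇ a ⟧ * (⟦ v x ≡ᵇ b ⟧ * g a b))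
        ≡⟨ ∑-cong (upTo p) (λ a → ∑-cong (upTo p) λ b → ∑-cong xs λ x → rearrange ⟦ u x ≡ᵇ a ⟧ ⟦ v x ≡ᵇ b ⟧ (g a b)) ⟩
      ∑[ a ← upTo p ] ∑[ b ← upTo p ] ∑[ x ← xs ] (g a b * (⟦ u x ≡ᵇ a ⟧ * ⟦ v x ≡ᵇ b ⟧))
        ≡⟨ ∑-cong (upTo p) (λ a → ∑-cong (upTo p) λ b → ∑-*ˡ xs (g a b) _) ⟩
      ∑∑ (λ a b → g a b * fibre a b) ∎
      where
      open ≡-Reasoning
      rearrange : ∀ x y z → x * (y * z) ≡ z * (x * y)
      rearrange = solve-∀

    collisions : ℕ
    collisions = ∑[ x ← xs ] ∑[ x′ ← xs ] (⟦ u x′ ≡ᵇ u x ⟧ * ⟦ v x′ ≡ᵇ v x ⟧)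

    -- Sum `deviation` over all pairs of residues. The fibres have mean `e` and their squares add up
    -- to `collisions`, so the squared deviations add up to collisions - p² e². The free parameter
    -- `K` replaces the square root of the Cauchy-Schwarz inequality.
    equidistribution : ∀ K e → length xs ≡ p * (p * e) → (F : ℕ → ℕ → Bool) →
      K * ∑[ x ← xs ] ⟦ F (u x) (v x) ⟧ + p * (p * (e * e)) ≤
      K * e * ∑∑ (λ a b → ⟦ F a b ⟧) + p * (p * (K * K)) + collisions
    equidistribution K e size F = +-cancelʳ-≤ (p * (p * (e * e))) _ _ (begin
      K * ∑[ x ← xs ] ⟦ F (u x) (v x) ⟧ + E + E
        ≡⟨ +-assoc _ E E ⟩
      K * ∑[ x ← xs ] ⟦ F (u x) (v x) ⟧ + (E + E)
        ≡⟨ cong₂ _+_ (cong (K *_) (∑-fibres (λ a b → ⟦ F a b ⟧))) mean ⟩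
      K * ∑∑ (λ a b → ⟦ F a b ⟧ * fibre a b) + 2 * (e * ∑∑ fibre)
        ≡⟨ cong₂ _+_ (∑∑-*ˡ K _) (trans (∑∑-*ˡ 2 _) (cong (2 *_) (∑∑-*ˡ e fibre))) ⟨
      ∑∑ (λ a b → K * (⟦ F a b ⟧ * fibre a b)) + ∑∑ (λ a b → 2 * (e * fibre a b))
        ≡⟨ ∑∑-+ _ _ ⟨
      ∑∑ (λ a b → K * (⟦ F a b ⟧ * fibre a b) + 2 * (e * fibre a b))
        ≤⟨ ∑-mono (upTo p) (λ a → ∑-mono (upTo p) λ b → deviation K e (fibre a b) (F a b)) ⟩
      ∑∑ (λ a b → K * e * ⟦ F a b ⟧ + K * K + (fibre a b * fibre a b + e * e))
        ≡⟨ trans (∑∑-+ _ _) (cong₂ _+_ (trans (∑∑-+ _ _) (cong₂ _+_ (∑∑-*ˡ (K * e) _) (∑∑-const (K * K))))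
                                       (trans (∑∑-+ _ _) (cong₂ _+_ (sym (∑-fibres fibre)) (∑∑-const (e * e))))) ⟩
      K * e * ∑∑ (λ a b → ⟦ F a b ⟧) + p * (p * (K * K)) + (∑[ x ← xs ] fibre (u x) (v x) + E)
        ≡⟨ +-assoc (K * e * ∑∑ (λ a b → ⟦ F a b ⟧) + p * (p * (K * K))) collisions E ⟨
      K * e * ∑∑ (λ a b → ⟦ F a b ⟧) + p * (p * (K * K)) + collisions + E ∎)
      where
      open ≤-Reasoning
      E = p * (p * (e * e))
      mean : E + E ≡ 2 * (e * ∑∑ fibre)
      mean = trans (double p e) (cong (λ z → 2 * (e * z)) (trans (sym size) (trans
        (trans (sym (*-identityʳ _)) (sym (∑-const xs 1)))
        (trans (∑-fibres (λ _ _ → 1)) (∑-cong (upTo p) λ a → ∑-cong (upTo p) λ b → *-identityˡ (fibre a b))))))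
        where
        double : ∀ p e → p * (p * (e * e)) + p * (p * (e * e)) ≡ 2 * (e * (p * (p * e)))
        double = solve-∀

  -- If s / p lies in the interval between a / M and b / M around 1/2, then 4 s / p is close to an
  -- integer.
  far-from-half : ∀ M a b L r s .{{_ : NonZero L}} .{{_ : NonZero (M * L + r)}} → r < L →
    suc a ≤ M → b + suc M ≤ 4 * a → 4 * b ≤ 2 * M + a →
    (s / L < a ⊎ b ≤ s / L) ⊎ ((4 * s) % (M * L + r) / L < a ⊎ b ≤ (4 * s) % (M * L + r) / L)
  far-from-half M a b L r s r<L a<M b+M<4a 4b≤2M+a with s / L <? a | b ≤? s / L
  ... | yes t<a | _       = inj₁ (inj₁ t<a)
  ... | no _    | yes b≤t = inj₁ (inj₂ b≤t)
  ... | no t≮a  | no b≰t  = inj₂ (cases (4 * s <? 2 * p))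
    where
    open ≤-Reasoning
    p = M * L + r
    p≤ : p ≤ suc M * L
    p≤ = ≤-trans (+-monoʳ-≤ (M * L) (<⇒≤ r<L)) (≤-reflexive (+-comm (M * L) L))
    lower : 4 * a * L ≤ 4 * s
    lower = begin
      4 * a * L         ≡⟨ *-assoc 4 a L ⟩
      4 * (a * L)       ≤⟨ *-monoʳ-≤ 4 (≤-trans (*-monoˡ-≤ L (≮⇒≥ t≮a)) (m/n*n≤m s L)) ⟩
      4 * s             ∎
    upper : 4 * s < 4 * b * L
    upper = begin-strict
      4 * s                       ≡⟨ cong (4 *_) (m≡m%n+[m/n]*n s L) ⟩
      4 * (s % L + s / L * L)     <⟨ *-monoʳ-< 4 (+-monoˡ-< (s / L * L) (m%n<n s L)) ⟩
      4 * (suc (s / L) * L)       ≤⟨ *-monoʳ-≤ 4 (*-monoˡ-≤ L (≰⇒> b≰t)) ⟩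
      4 * (b * L)                 ≡⟨ *-assoc 4 b L ⟨
      4 * b * L                   ∎
    reduce : ∀ k y → k * p + y ≡ 4 * s → y < p → y ≡ (4 * s) % p
    reduce k y eq y<p = trans (sym ([k*n+m]%n≡m k p y y<p)) (cong (_% p) eq)
    p+bL≤4s : p + b * L ≤ 4 * s
    p+bL≤4s = begin
      p + b * L             ≤⟨ +-monoˡ-≤ (b * L) p≤ ⟩
      suc M * L + b * L     ≡⟨ +-comm (suc M * L) (b * L) ⟩
      b * L + suc M * L     ≡⟨ *-distribʳ-+ L b (suc M) ⟨
      (b + suc M) * L       ≤⟨ *-monoˡ-≤ L b+M<4a ⟩
      4 * a * L             ≤⟨ lower ⟩
      4 * s                 ∎
    -- By `p+bL≤4s` and `upper`, `4 * s` lies between p + b L and 2 p + a L. Below 2 p its residue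
    -- is at least b L, and from 2 p on it is less than a L.
    cases : Dec (4 * s < 2 * p) → (4 * s) % p / L < a ⊎ b ≤ (4 * s) % p / L
    cases (yes 4s<2p) with y , eq ← m≤n⇒∃[o]m+o≡n (m+n≤o⇒m≤o p p+bL≤4s) =
      inj₂ (subst (λ z → b ≤ z / L) (reduce 1 y (trans (cong (_+ y) (*-identityˡ p)) eq) y<p)
        (≤-trans (≤-reflexive (sym (m*n/n≡m b L))) (/-monoˡ-≤ L bL≤y)))
      where
      y<p : y < p
      y<p = +-cancelˡ-< p y p (begin-strict
        p + y    ≡⟨ eq ⟩
        4 * s    <⟨ 4s<2p ⟩
        2 * p    ≡⟨ cong (p +_) (+-identityʳ p) ⟩
        p + p    ∎)
      bL≤y : b * L ≤ y
      bL≤y = +-cancelˡ-≤ p _ _ (≤-trans p+bL≤4s (≤-reflexive (sym eq)))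
    cases (no 4s≮2p) with y , eq ← m≤n⇒∃[o]m+o≡n (≮⇒≥ 4s≮2p) =
      inj₁ (subst (λ z → z / L < a) (reduce 2 y eq (<-trans y<aL aL<p)) (m<n*o⇒m/o<n y<aL))
      where
      y<aL : y < a * L
      y<aL = +-cancelˡ-< (2 * p) y _ (begin-strict
        2 * p + y                   ≡⟨ eq ⟩
        4 * s                       <⟨ upper ⟩
        4 * b * L                   ≤⟨ *-monoˡ-≤ L 4b≤2M+a ⟩
        (2 * M + a) * L             ≡⟨ *-distribʳ-+ L (2 * M) a ⟩
        2 * M * L + a * L           ≡⟨ cong (_+ a * L) (*-assoc 2 M L) ⟩
        2 * (M * L) + a * L         ≤⟨ +-monoˡ-≤ (a * L) (*-monoʳ-≤ 2 (m≤m+n (M * L) r)) ⟩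
        2 * p + a * L               ∎)
      aL<p : a * L < p
      aL<p = ≤-trans (*-monoˡ-< L a<M) (m≤m+n (M * L) r)

  -- Quadratic forms modulo p

  module Modular (p : ℕ) .{{_ : NonZero p}} where

    infix 4 _≋_

    -- A record instead of an abbreviation for the equation of remainders, so that `a` and `b` can
    -- be inferred from the type.
    record _≋_ (a b : ℕ) : Set where
      constructor mod≡
      field %-≡ : a % p ≡ b % p

    open _≋_ public

    ≋-refl : ∀ {a} → a ≋ a
    ≋-refl = mod≡ refl

    ≋-sym : ∀ {a b} → a ≋ b → b ≋ a
    ≋-sym (mod≡ e) = mod≡ (sym e)

    ≋-trans : ∀ {a b c} → a ≋ b → b ≋ c → a ≋ c
    ≋-trans (mod≡ e) (mod≡ f) = mod≡ (trans e f)

    ≡⇒≋ : ∀ {a b} → a ≡ b → a ≋ b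
    ≡⇒≋ refl = ≋-refl

    %-≋ : ∀ a → a % p ≋ a
    %-≋ a = mod≡ (m%n%n≡m%n a p)

    +-≋ : ∀ {a b c d} → a ≋ b → c ≋ d → a + c ≋ b + d
    +-≋ {a} {b} {c} {d} (mod≡ e) (mod≡ f) = mod≡ (trans (%-distribˡ-+ a c p)
      (trans (cong₂ (λ x y → (x + y) % p) e f) (sym (%-distribˡ-+ b d p))))

    *-≋ : ∀ {a b c d} → a ≋ b → c ≋ d → a * c ≋ b * d
    *-≋ {a} {b} {c} {d} (mod≡ e) (mod≡ f) = mod≡ (trans (%-distribˡ-* a c p)
      (trans (cong₂ (λ x y → (x * y) % p) e f) (sym (%-distribˡ-* b d p))))

    ≋-cancelʳ : ∀ c {a b} → a + c ≋ b + c → a ≋ b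
    ≋-cancelʳ c {a} {b} eq = ≋-trans (≋-sym (undo a)) (≋-trans (+-≋ eq ≋-refl) (undo b))
      where
      -- `p ∸ c % p` represents the negative of `c`.
      undo : ∀ a → a + c + (p ∸ c % p) ≋ a
      undo a = mod≡ (begin
        (a + c + (p ∸ c % p)) % p             ≡⟨ cong (λ z → (a + z + (p ∸ c % p)) % p) (m≡m%n+[m/n]*n c p) ⟩
        (a + (c % p + c / p * p) + (p ∸ c % p)) % p ≡⟨ cong (_% p) (rearrange a (c % p) (c / p * p) (p ∸ c % p)) ⟩
        (a + c / p * p + (c % p + (p ∸ c % p))) % p ≡⟨ cong (λ z → (a + c / p * p + z) % p) (m+[n∸m]≡n (<⇒≤ (m%n<n c p))) ⟩
        (a + c / p * p + p) % p               ≡⟨ [m+n]%n≡m%n (a + c / p * p) p ⟩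
        (a + c / p * p) % p                   ≡⟨ [m+kn]%n≡m%n a (c / p) p ⟩
        a % p                                 ∎)
        where
        open ≡-Reasoning
        rearrange : ∀ a x y z → a + (x + y) + z ≡ a + y + (x + z)
        rearrange = solve-∀

    ≋-cancelˡ : ∀ c {a b} → c + a ≋ c + b → a ≋ b
    ≋-cancelˡ c {a} {b} eq = ≋-cancelʳ c (subst₂ _≋_ (+-comm c a) (+-comm c b) eq)

    ≋⇒≡ : ∀ {a b} → a < p → b < p → a ≋ b → a ≡ b
    ≋⇒≡ a<p b<p (mod≡ e) = trans (sym (m<n⇒m%n≡m a<p)) (trans e (m<n⇒m%n≡m b<p))

    toℕ-mod : ∀ k → toℕ (k mod p) ≡ k % p
    toℕ-mod k = toℕ-fromℕ< (m%n<n k p)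

    Q : ∀ {n} → 𝔽^ p n → ℕ
    Q []      = 0
    Q (a ∷ x) = toℕ a * toℕ a + Q x

    B : ∀ {n} → 𝔽^ p n → 𝔽^ p n → ℕ
    B []      []      = 0
    B (a ∷ x) (b ∷ y) = toℕ a * toℕ b + B x y

    ⊕-≋ : ∀ (a b : Fin p) → toℕ ((toℕ a + toℕ b) mod p) ≋ toℕ a + toℕ b
    ⊕-≋ a b = ≋-trans (≡⇒≋ (toℕ-mod (toℕ a + toℕ b))) (%-≋ _)

    ·-≋ : ∀ k (a : Fin p) → toℕ ((k * toℕ a) mod p) ≋ k * toℕ a
    ·-≋ k a = ≋-trans (≡⇒≋ (toℕ-mod (k * toℕ a))) (%-≋ _)

    B-comm : ∀ {n} (x y : 𝔽^ p n) → B x y ≡ B y x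
    B-comm []      []      = refl
    B-comm (a ∷ x) (b ∷ y) = cong₂ _+_ (*-comm (toℕ a) (toℕ b)) (B-comm x y)

    B-⊕ : ∀ {n} (x y z : 𝔽^ p n) → B (x ⊕ y) z ≋ B x z + B y z
    B-⊕ []      []      []      = ≋-refl
    B-⊕ (a ∷ x) (b ∷ y) (c ∷ z) = ≋-trans
      (+-≋ (*-≋ {c = toℕ c} (⊕-≋ a b) ≋-refl) (B-⊕ x y z))
      (≡⇒≋ (rearrange (toℕ a) (toℕ b) (toℕ c) (B x z) (B y z)))
      where
      rearrange : ∀ a b c u v → (a + b) * c + (u + v) ≡ a * c + u + (b * c + v)
      rearrange = solve-∀

    Q-⊕ : ∀ {n} (x y : 𝔽^ p n) → Q (x ⊕ y) ≋ Q x + 2 * B x y + Q y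
    Q-⊕ []      []      = ≋-refl
    Q-⊕ (a ∷ x) (b ∷ y) = ≋-trans
      (+-≋ (*-≋ (⊕-≋ a b) (⊕-≋ a b)) (Q-⊕ x y))
      (≡⇒≋ (rearrange (toℕ a) (toℕ b) (Q x) (B x y) (Q y)))
      where
      rearrange : ∀ a b q u v → (a + b) * (a + b) + (q + 2 * u + v) ≡ a * a + q + 2 * (a * b + u) + (b * b + v)
      rearrange = solve-∀

    B-· : ∀ {n} k (x y : 𝔽^ p n) → B x (k · y) ≋ k * B x y
    B-· k []      []      = ≡⇒≋ (sym (*-zeroʳ k))
    B-· k (a ∷ x) (b ∷ y) = ≋-trans
      (+-≋ (*-≋ {a = toℕ a} ≋-refl (·-≋ k b)) (B-· k x y))
      (≡⇒≋ (rearrange k (toℕ a) (toℕ b) (B x y)))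
      where
      rearrange : ∀ k a b u → a * (k * b) + k * u ≡ k * (a * b + u)
      rearrange = solve-∀

    Q-· : ∀ {n} k (x : 𝔽^ p n) → Q (k · x) ≋ k * k * Q x
    Q-· k []      = ≡⇒≋ (sym (*-zeroʳ (k * k)))
    Q-· k (a ∷ x) = ≋-trans
      (+-≋ (*-≋ (·-≋ k a) (·-≋ k a)) (Q-· k x))
      (≡⇒≋ (rearrange k (toℕ a) (Q x)))
      where
      rearrange : ∀ k a q → k * a * (k * a) + k * k * q ≡ k * k * (a * a + q)
      rearrange = solve-∀

    Q-second-difference : ∀ {n} (x d : 𝔽^ p n) → Q (x ⊕ 2 · d) + Q x ≋ 2 * Q (x ⊕ d) + 2 * Q d
    Q-second-difference x d = ≋-trans
      (+-≋ (≋-trans (Q-⊕ x (2 · d)) (+-≋ (+-≋ {a = Q x} ≋-refl (*-≋ {a = 2} ≋-refl (B-· 2 x d))) (Q-· 2 d))) ≋-refl)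
      (≋-trans (≡⇒≋ (rearrange (Q x) (B x d) (Q d)))
        (+-≋ (*-≋ {a = 2} ≋-refl (≋-sym (Q-⊕ x d))) ≋-refl))
      where
      rearrange : ∀ q b r → q + 2 * (2 * b) + 2 * 2 * r + q ≡ 2 * (q + 2 * b + r) + 2 * r
      rearrange = solve-∀

    -- Induction on the dimension: in one coordinate, adding a constant is a cyclic shift of a full
    -- period.
    ∑-translate : ∀ n (f : 𝔽^ p n → ℕ) (x : 𝔽^ p n) → ∑[ h ← points p n ] f (x ⊕ h) ≡ ∑ (points p n) f
    ∑-translate zero    f []      = refl
    ∑-translate (suc n) f (a ∷ x) = begin
      ∑[ h ← points p (suc n) ] f ((a ∷ x) ⊕ h)
        ≡⟨ ∑-points p n _ ⟩
      ∑[ b ← allFin p ] ∑[ h ← points p n ] f ((toℕ a + toℕ b) mod p ∷ x ⊕ h)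
        ≡⟨ ∑-cong (allFin p) (λ b → ∑-translate n (λ y → f ((toℕ a + toℕ b) mod p ∷ y)) x) ⟩
      ∑[ b ← allFin p ] g (toℕ a + toℕ b)
        ≡⟨ ∑-allFin p (λ b → g (toℕ a + b)) ⟩
      ∑[ b ← upTo p ] g (toℕ a + b)
        ≡⟨ ∑-upTo-shift p g periodic (toℕ a) ⟩
      ∑ (upTo p) g
        ≡⟨ ∑-allFin p g ⟨
      ∑[ b ← allFin p ] g (toℕ b)
        ≡⟨ ∑-cong (allFin p) (λ b → cong (λ c → ∑[ y ← points p n ] f (c ∷ y)) (mod-toℕ b)) ⟩
      ∑[ b ← allFin p ] ∑[ y ← points p n ] f (b ∷ y)
        ≡⟨ ∑-points p n f ⟨
      ∑ (points p (suc n)) f ∎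
      where
      open ≡-Reasoning
      g : ℕ → ℕ
      g b = ∑[ y ← points p n ] f (b mod p ∷ y)
      mod-cong : ∀ {b c} → b ≋ c → b mod p ≡ c mod p
      mod-cong {b} {c} (mod≡ e) = toℕ-injective (trans (toℕ-mod b) (trans e (sym (toℕ-mod c))))
      periodic : ∀ i → g (p + i) ≡ g i
      periodic i = cong (λ c → ∑[ y ← points p n ] f (c ∷ y))
        (mod-cong (mod≡ (trans (cong (_% p) (+-comm p i)) ([m+n]%n≡m%n i p))))
      mod-toℕ : ∀ b → toℕ b mod p ≡ b
      mod-toℕ b = toℕ-injective (trans (toℕ-mod (toℕ b)) (m<n⇒m%n≡m (toℕ<n b)))

    is-zero : ∀ {n} → 𝔽^ p n → Bool
    is-zero []      = true
    is-zero (a ∷ x) = (0 ≡ᵇ toℕ a) ∧ is-zero x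

    is-zero⇒≡𝟎 : ∀ {n} (x : 𝔽^ p n) → is-zero x ≡ true → x ≡ 𝟎
    is-zero⇒≡𝟎 []      _ = refl
    is-zero⇒≡𝟎 (a ∷ x) h with toℕ a in eq
    ... | zero = cong₂ _∷_ (toℕ-injective (trans eq (sym (trans (toℕ-mod 0) (m<n⇒m%n≡m (>-nonZero⁻¹ p)))))) (is-zero⇒≡𝟎 x h)

    ≢𝟎⇒is-zero : ∀ {n} (x : 𝔽^ p n) → x ≢ 𝟎 → is-zero x ≡ false
    ≢𝟎⇒is-zero x x≢𝟎 with is-zero x in eq
    ... | false = refl
    ... | true  = contradiction (is-zero⇒≡𝟎 x eq) x≢𝟎

    ⟦∧⟧ : ∀ b c → ⟦ b ∧ c ⟧ ≡ ⟦ b ⟧ * ⟦ c ⟧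
    ⟦∧⟧ true  c = sym (+-identityʳ ⟦ c ⟧)
    ⟦∧⟧ false c = refl

    ∑-is-zero : ∀ n → ∑[ x ← points p n ] ⟦ is-zero x ⟧ ≡ 1
    ∑-is-zero zero    = refl
    ∑-is-zero (suc n) = begin
      ∑[ x ← points p (suc n) ] ⟦ is-zero x ⟧
        ≡⟨ ∑-points p n _ ⟩
      ∑[ a ← allFin p ] ∑[ x ← points p n ] ⟦ (0 ≡ᵇ toℕ a) ∧ is-zero x ⟧
        ≡⟨ ∑-cong (allFin p) (λ a → trans (∑-cong (points p n) λ x → ⟦∧⟧ (0 ≡ᵇ toℕ a) (is-zero x))
             (trans (∑-*ˡ (points p n) ⟦ 0 ≡ᵇ toℕ a ⟧ _) (cong (⟦ 0 ≡ᵇ toℕ a ⟧ *_) (∑-is-zero n)))) ⟩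
      ∑[ a ← allFin p ] (⟦ 0 ≡ᵇ toℕ a ⟧ * 1)
        ≡⟨ ∑-allFin p (λ a → ⟦ 0 ≡ᵇ a ⟧ * 1) ⟩
      ∑[ a ← upTo p ] (⟦ 0 ≡ᵇ a ⟧ * 1)
        ≡⟨ ∑-upTo-≡ᵇ p 0 (>-nonZero⁻¹ p) (λ _ → 1) ⟩
      1 ∎
      where open ≡-Reasoning

    null : ℕ → Bool
    null a = a % p ≡ᵇ 0

    null⇒≋0 : ∀ a → null a ≡ true → a ≋ 0
    null⇒≋0 a h = mod≡ (trans (≡ᵇ⇒≡ (a % p) 0 (Equivalence.from T-≡ h)) (sym (m<n⇒m%n≡m (>-nonZero⁻¹ p))))

    ≋0⇒null : ∀ a → a ≋ 0 → T (null a)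
    ≋0⇒null a (mod≡ e) = ≡⇒≡ᵇ (a % p) 0 (trans e (m<n⇒m%n≡m (>-nonZero⁻¹ p)))

    module _ (p-prime : Prime p) (2<p : 2 < p) where

      *-cancel-≋0 : ∀ {a b} → 0 < a → a < p → a * b ≋ 0 → b ≋ 0
      *-cancel-≋0 {a} {b} 0<a a<p (mod≡ e)
        with euclidsLemma a b p-prime (m%n≡0⇒n∣m (a * b) p (trans e (m<n⇒m%n≡m (>-nonZero⁻¹ p))))
      ... | inj₁ p∣a = contradiction p∣a (>⇒∤ {{>-nonZero 0<a}} a<p)
      ... | inj₂ p∣b = mod≡ (trans (n∣m⇒m%n≡0 b p p∣b) (sym (m<n⇒m%n≡m (>-nonZero⁻¹ p))))

      *-cancelˡ-≋ : ∀ {a i j} → 0 < a → a < p → i ≤ j → a * i ≋ a * j → i ≋ j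
      *-cancelˡ-≋ {a} {i} {j} 0<a a<p i≤j eq with k , refl ← m≤n⇒∃[o]m+o≡n i≤j =
        ≋-sym (≋-trans (+-≋ {a = i} ≋-refl (*-cancel-≋0 0<a a<p (≋-sym (≋-cancelˡ (a * i)
          (subst₂ _≋_ (sym (+-identityʳ (a * i))) (*-distribˡ-+ a i k) eq))))) (≡⇒≋ (+-identityʳ i)))

      linear-root-unique : ∀ {a c i j} → 0 < a → a < p → i < p → j < p →
        c + 2 * (a * i) ≋ 0 → c + 2 * (a * j) ≋ 0 → i ≡ j
      linear-root-unique {a} {c} {i} {j} 0<a a<p i<p j<p ci cj = ≋⇒≡ i<p j<p i≋j
        where
        halve : ∀ {x y} → x ≤ y → 2 * (a * x) ≋ 2 * (a * y) → x ≋ y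
        halve x≤y eq = *-cancelˡ-≋ 0<a a<p x≤y (*-cancelˡ-≋ z<s 2<p (*-monoʳ-≤ a x≤y) eq)
        2ai≋2aj = ≋-cancelˡ c (≋-trans ci (≋-sym cj))
        i≋j : i ≋ j
        i≋j with ≤-total i j
        ... | inj₁ i≤j = halve i≤j 2ai≋2aj
        ... | inj₂ j≤i = ≋-sym (halve j≤i (≋-sym 2ai≋2aj))

      -- The recursion looks for a nonzero coordinate of `w`. Once the other coordinates of `x` are
      -- fixed, the condition is linear in this one with an invertible coefficient, as p is an odd
      -- prime, so at most one value remains.
      hyperplane : ∀ k (w : 𝔽^ p (suc k)) → is-zero w ≡ false → ∀ c →
        ∑[ x ← points p (suc k) ] ⟦ null (c + 2 * B w x) ⟧ ≤ p ^ k
      hyperplane k (a ∷ w) w≢0 c with toℕ a in toℕa≡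
      ... | suc a′ = begin
        ∑[ x ← points p (suc k) ] ⟦ null (c + 2 * B (a ∷ w) x) ⟧
          ≡⟨ trans (∑-points p k _) (∑-swap (allFin p) (points p k) _) ⟩
        ∑[ x ← points p k ] ∑[ b ← allFin p ] ⟦ null (c + 2 * (toℕ a * toℕ b + B w x)) ⟧
          ≤⟨ ∑-mono (points p k) (λ x → ≤-trans (≤-reflexive (trans
               (∑-cong (allFin p) λ b → cong (⟦_⟧ ∘ null) (rearrange c (toℕ a) (toℕ b) (B w x)))
               (∑-allFin p (λ b → ⟦ null (c + 2 * B w x + 2 * (toℕ a * b)) ⟧))))
               (∑-upTo-at-most-one p (λ b → null (c + 2 * B w x + 2 * (toℕ a * b))) λ i j i<p j<p ni nj →
                 linear-root-unique {c = c + 2 * B w x} (subst (0 <_) (sym toℕa≡) z<s) (toℕ<n a) i<p j<p (null⇒≋0 _ ni) (null⇒≋0 _ nj))) ⟩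
        ∑[ x ← points p k ] 1
          ≡⟨ trans (∑-const (points p k) 1) (trans (*-identityʳ _) (length-points p k)) ⟩
        p ^ k ∎
        where
        open ≤-Reasoning
        rearrange : ∀ c a b u → c + 2 * (a * b + u) ≡ c + 2 * u + 2 * (a * b)
        rearrange = solve-∀
      hyperplane zero    (a ∷ []) () c | zero
      hyperplane (suc k) (a ∷ w) w≢0 c | zero = begin
        ∑[ x ← points p (suc (suc k)) ] ⟦ null (c + 2 * B (a ∷ w) x) ⟧
          ≡⟨ ∑-points p (suc k) _ ⟩
        ∑[ b ← allFin p ] ∑[ x ← points p (suc k) ] ⟦ null (c + 2 * (toℕ a * toℕ b + B w x)) ⟧
          ≡⟨ ∑-cong (allFin p) (λ b → ∑-cong (points p (suc k)) λ x → cong (λ z → ⟦ null (c + 2 * (z * toℕ b + B w x)) ⟧) toℕa≡) ⟩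
        ∑[ b ← allFin p ] ∑[ x ← points p (suc k) ] ⟦ null (c + 2 * B w x) ⟧
          ≤⟨ ∑-mono (allFin p) (λ b → hyperplane k w w≢0 c) ⟩
        ∑[ b ← allFin p ] p ^ k
          ≡⟨ trans (∑-allFin p (λ _ → p ^ k)) (∑-upTo-const p (p ^ k)) ⟩
        p ^ suc k ∎
        where open ≤-Reasoning

  -- Joint equidistribution of Q x and Q (x + d)

  module Equidistribution (p : ℕ) .{{_ : NonZero p}} (p-prime : Prime p) (2<p : 2 < p) where

    open Modular p

    ⊕-comm : ∀ {n} (x y : 𝔽^ p n) → x ⊕ y ≡ y ⊕ x
    ⊕-comm = zipWith-comm λ a b → cong (_mod p) (+-comm (toℕ a) (toℕ b))

    ∑-translateʳ : ∀ n (f : 𝔽^ p n → ℕ) (d : 𝔽^ p n) → ∑[ x ← points p n ] f (x ⊕ d) ≡ ∑ (points p n) f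
    ∑-translateʳ n f d = trans (∑-cong (points p n) λ x → cong f (⊕-comm x d)) (∑-translate n f d)

    module _ {n : ℕ} (d : 𝔽^ p n) where

      open Moment (points p n) p (λ x → Q x % p) (λ x → Q (x ⊕ d) % p)
        (λ x → m%n<n (Q x) p) (λ x → m%n<n (Q (x ⊕ d)) p) public

    -- Expanding Q (x + h) - Q x gives the first condition. Translation by `d` changes this
    -- difference by 2 B (h, d), which does not involve `x`; as both differences vanish, so does
    -- this term.
    collision⇒null : ∀ {n} (d x h : 𝔽^ p n) → Q (x ⊕ h) ≋ Q x → Q (x ⊕ h ⊕ d) ≋ Q (x ⊕ d) →
      Q h + 2 * B h x ≋ 0 × 2 * B d h ≋ 0
    collision⇒null d x h e f =
      ≋-cancelˡ (Q x) (≋-trans (≡⇒≋ (trans (cong (λ z → Q x + (Q h + 2 * z)) (B-comm h x)) (rearrange₁ (Q x) (Q h) (B x h))))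
        (≋-trans (≋-sym (Q-⊕ x h)) (≋-trans e (≡⇒≋ (sym (+-identityʳ (Q x))))))) ,
      ≋-cancelˡ (Q x + 2 * B x d + Q d) (≋-trans (≡⇒≋ (trans (cong (λ z → Q x + 2 * B x d + Q d + 2 * z) (B-comm d h)) (rearrange₂ (Q x) (B x d) (Q d) (B h d))))
        (≋-trans (≋-sym expand) (≋-trans f (≋-trans (Q-⊕ x d) (≡⇒≋ (sym (+-identityʳ _)))))))
      where
      expand : Q (x ⊕ h ⊕ d) ≋ Q x + 2 * (B x d + B h d) + Q d
      expand = ≋-trans (Q-⊕ (x ⊕ h) d) (+-≋ {c = Q d} (+-≋ e (*-≋ {a = 2} ≋-refl (B-⊕ x h d))) ≋-refl)
      rearrange₁ : ∀ q r b → q + (r + 2 * b) ≡ q + 2 * b + r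
      rearrange₁ = solve-∀
      rearrange₂ : ∀ q b r c → q + 2 * b + r + 2 * c ≡ q + 2 * (b + c) + r
      rearrange₂ = solve-∀

    -- Write the second point as `x ⊕ h`. The condition on `B d h` leaves at most `p ^ k` shifts
    -- `h`. By the other condition a nonzero shift admits at most `p ^ k` points `x`, and the zero
    -- shift admits all of them.
    collisions≤ : ∀ k (d : 𝔽^ p (suc k)) → is-zero d ≡ false → collisions d ≤ p ^ k * p ^ k + p ^ suc k
    collisions≤ k d d≢0 = begin
      collisions d
        ≡⟨ ∑-cong pts (λ x → ∑-translate (suc k) (λ x′ → ⟦ Q x′ % p ≡ᵇ Q x % p ⟧ * ⟦ Q (x′ ⊕ d) % p ≡ᵇ Q (x ⊕ d) % p ⟧) x) ⟨
      ∑[ x ← pts ] ∑[ h ← pts ] (⟦ Q (x ⊕ h) % p ≡ᵇ Q x % p ⟧ * ⟦ Q (x ⊕ h ⊕ d) % p ≡ᵇ Q (x ⊕ d) % p ⟧)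
        ≤⟨ ∑-mono pts (λ x → ∑-mono pts λ h → to-linear x h) ⟩
      ∑[ x ← pts ] ∑[ h ← pts ] (⟦ null (0 + 2 * B d h) ⟧ * ⟦ null (Q h + 2 * B h x) ⟧)
        ≡⟨ ∑-swap pts pts _ ⟩
      ∑[ h ← pts ] ∑[ x ← pts ] (⟦ null (0 + 2 * B d h) ⟧ * ⟦ null (Q h + 2 * B h x) ⟧)
        ≡⟨ ∑-cong pts (λ h → ∑-*ˡ pts ⟦ null (0 + 2 * B d h) ⟧ _) ⟩
      ∑[ h ← pts ] (⟦ null (0 + 2 * B d h) ⟧ * ∑[ x ← pts ] ⟦ null (Q h + 2 * B h x) ⟧)
        ≤⟨ ∑-mono pts per-shift ⟩
      ∑[ h ← pts ] (⟦ null (0 + 2 * B d h) ⟧ * p ^ k + ⟦ is-zero h ⟧ * p ^ suc k)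
        ≡⟨ trans (∑-+ pts _ _) (cong₂ _+_ (∑-*ʳ pts _ (p ^ k)) (trans (∑-*ʳ pts _ (p ^ suc k)) (cong (_* p ^ suc k) (∑-is-zero (suc k))))) ⟩
      ∑[ h ← pts ] ⟦ null (0 + 2 * B d h) ⟧ * p ^ k + 1 * p ^ suc k
        ≤⟨ +-mono-≤ (*-monoˡ-≤ (p ^ k) (hyperplane p-prime 2<p k d d≢0 0)) (≤-reflexive (*-identityˡ _)) ⟩
      p ^ k * p ^ k + p ^ suc k ∎
      where
      open ≤-Reasoning
      pts = points p (suc k)
      to-linear : ∀ x h → ⟦ Q (x ⊕ h) % p ≡ᵇ Q x % p ⟧ * ⟦ Q (x ⊕ h ⊕ d) % p ≡ᵇ Q (x ⊕ d) % p ⟧ ≤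
        ⟦ null (0 + 2 * B d h) ⟧ * ⟦ null (Q h + 2 * B h x) ⟧
      to-linear x h = subst₂ _≤_ (⟦∧⟧ (Q (x ⊕ h) % p ≡ᵇ Q x % p) _) (⟦∧⟧ (null (0 + 2 * B d h)) _) (T⟦⟧≤ λ s →
        let e , f = Equivalence.to (T-∧ {Q (x ⊕ h) % p ≡ᵇ Q x % p}) s
            u , v = collision⇒null d x h (mod≡ (≡ᵇ⇒≡ _ _ e)) (mod≡ (≡ᵇ⇒≡ _ _ f))
        in Equivalence.from T-∧ (≋0⇒null _ v , ≋0⇒null _ u))
      per-shift : ∀ h → ⟦ null (0 + 2 * B d h) ⟧ * ∑[ x ← pts ] ⟦ null (Q h + 2 * B h x) ⟧ ≤
        ⟦ null (0 + 2 * B d h) ⟧ * p ^ k + ⟦ is-zero h ⟧ * p ^ suc k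
      per-shift h with is-zero h in z
      ... | false = ≤-trans (*-monoʳ-≤ ⟦ null (0 + 2 * B d h) ⟧ (hyperplane p-prime 2<p k h z (Q h))) (m≤m+n _ 0)
      ... | true  = begin
        ⟦ null (0 + 2 * B d h) ⟧ * ∑[ x ← pts ] ⟦ null (Q h + 2 * B h x) ⟧
          ≤⟨ *-mono-≤ (⟦⟧≤1 (null (0 + 2 * B d h))) (∑-mono pts λ x → ⟦⟧≤1 (null (Q h + 2 * B h x))) ⟩
        1 * ∑[ x ← pts ] 1
          ≡⟨ cong (1 *_) (trans (∑-const pts 1) (trans (*-identityʳ _) (length-points p (suc k)))) ⟩
        1 * p ^ suc k
          ≤⟨ m≤n+m (1 * p ^ suc k) (⟦ null (0 + 2 * B d h) ⟧ * p ^ k) ⟩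
        ⟦ null (0 + 2 * B d h) ⟧ * p ^ k + 1 * p ^ suc k ∎

    -- The error 2 p ^ (3 + m) comes from the choice K = p ^ (1 + m) in the second moment bound.
    equidistributed : ∀ m (d : 𝔽^ p (4 + m)) → is-zero d ≡ false → (F : ℕ → ℕ → Bool) →
      ∑[ x ← points p (4 + m) ] ⟦ F (Q x % p) (Q (x ⊕ d) % p) ⟧ ≤ p ^ (2 + m) * (∑∑ d (λ a b → ⟦ F a b ⟧) + 2 * p)
    equidistributed m d d≢0 F = *-cancelˡ-≤ K {{m^n≢0 p (1 + m)}} (+-cancelʳ-≤ (p * (p * (e * e))) _ _ (begin
      K * count + p * (p * (e * e))
        ≤⟨ equidistribution d K e (length-points p (4 + m)) F ⟩
      K * e * f + p * (p * (K * K)) + collisions d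
        ≤⟨ +-monoʳ-≤ (K * e * f + p * (p * (K * K))) (collisions≤ (3 + m) d d≢0) ⟩
      K * e * f + p * (p * (K * K)) + (p * e * (p * e) + p * (p * e))
        ≤⟨ +-monoʳ-≤ (K * e * f + p * (p * (K * K))) (+-monoʳ-≤ (p * e * (p * e)) (*-monoˡ-≤ (p * e) p≤K)) ⟩
      K * e * f + p * (p * (K * K)) + (p * e * (p * e) + K * (p * e))
        ≡⟨ rearrange K p f ⟩
      K * (e * (f + 2 * p)) + p * (p * (e * e)) ∎))
      where
      open ≤-Reasoning
      K = p ^ (1 + m)
      e = p * K
      f = ∑∑ d (λ a b → ⟦ F a b ⟧)
      count = ∑[ x ← points p (4 + m) ] ⟦ F (Q x % p) (Q (x ⊕ d) % p) ⟧
      -- Dimension at least 4 enters here: the zero shift contributes `p ^ (4 + m)` collisions,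
      -- which is at most `K * p ^ (3 + m)`.
      p≤K : p ≤ K
      p≤K = ≤-trans (≤-reflexive (sym (*-identityʳ p))) (*-monoʳ-≤ p (m^n>0 p m))
      rearrange : ∀ K p f → K * (p * K) * f + p * (p * (K * K)) + (p * (p * K) * (p * (p * K)) + K * (p * (p * K))) ≡
        K * (p * K * (f + 2 * p)) + p * (p * (p * K * (p * K)))
      rearrange = solve-∀

    -- The first marginal of `equidistributed`.
    distribution : ∀ m (d : 𝔽^ p (4 + m)) → is-zero d ≡ false → (G : ℕ → Bool) →
      ∑[ x ← points p (4 + m) ] ⟦ G (Q x % p) ⟧ ≤ p ^ (2 + m) * (p * ∑[ a ← upTo p ] ⟦ G a ⟧ + 2 * p)
    distribution m d d≢0 G = ≤-trans (equidistributed m d d≢0 (λ a _ → G a))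
      (≤-reflexive (cong (λ z → p ^ (2 + m) * (z + 2 * p))
        (trans (∑-cong (upTo p) λ a → ∑-upTo-const p ⟦ G a ⟧) (∑-*ˡ (upTo p) p _))))

    is-zero-2· : ∀ {n} (d : 𝔽^ p n) → is-zero (2 · d) ≡ true → is-zero d ≡ true
    is-zero-2· []      _ = refl
    is-zero-2· (a ∷ d) h = Equivalence.to T-≡ (Equivalence.from T-∧ (≡⇒≡ᵇ 0 (toℕ a) (sym a≡0) ,
        Equivalence.from T-≡ (is-zero-2· d (Equivalence.to T-≡ (proj₂ split)))))
      where
      split = Equivalence.to (T-∧ {0 ≡ᵇ toℕ ((2 * toℕ a) mod p)}) (Equivalence.from T-≡ h)
      a≡0 : toℕ a ≡ 0
      a≡0 = ≋⇒≡ (toℕ<n a) (>-nonZero⁻¹ p) (*-cancel-≋0 p-prime 2<p z<s 2<p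
        (≋-trans (≋-sym (·-≋ 2 a)) (≡⇒≋ (sym (≡ᵇ⇒≡ 0 _ (proj₁ split))))))

    2·-nonzero : ∀ {n} (d : 𝔽^ p n) → is-zero d ≡ false → is-zero (2 · d) ≡ false
    2·-nonzero d d≢0 with is-zero (2 · d) in z
    ... | false = refl
    ... | true  with () ← trans (sym (is-zero-2· d z)) d≢0

  -- Progressions in the level sets of Q

  progressions : ∀ {p n} .{{_ : NonZero p}} → 𝒫 p n → 𝔽^ p n → ℕ
  progressions {p} {n} A d = ∑[ x ← points p n ] ⟦ A x ∧ (A (x ⊕ d) ∧ A (x ⊕ 2 · d)) ⟧

  -- Union bound: a progression in the larger set that is not contained in the smaller one has a
  -- term in the difference.
  three-terms : ∀ a₁ b₁ c₁ a₀ b₀ c₀ → ⟦ a₁ ∧ (b₁ ∧ c₁) ⟧ ≤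
    ⟦ a₀ ∧ (b₀ ∧ c₀) ⟧ + (⟦ a₁ ∧ not a₀ ⟧ + (⟦ b₁ ∧ not b₀ ⟧ + ⟦ c₁ ∧ not c₀ ⟧))
  three-terms false _     _     _     _     _     = z≤n
  three-terms true  false _     _     _     _     = z≤n
  three-terms true  true  false _     _     _     = z≤n
  three-terms true  true  true  false _     _     = s≤s z≤n
  three-terms true  true  true  true  false _     = s≤s z≤n
  three-terms true  true  true  true  true  false = s≤s z≤n
  three-terms true  true  true  true  true  true  = s≤s z≤n

  ∑-top : ∀ n g → ∑[ α ← upTo n ] ⟦ not (α + g <ᵇ n) ⟧ ≤ g
  ∑-top n g with ≤-total n g
  ... | inj₁ n≤g = ≤-trans (∑-mono (upTo n) λ α → ⟦⟧≤1 (not (α + g <ᵇ n)))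
    (≤-trans (≤-reflexive (trans (∑-upTo-const n 1) (*-identityʳ n))) n≤g)
  ... | inj₂ g≤n with k , eq ← m≤n⇒∃[o]m+o≡n g≤n with refl ← trans (+-comm k g) eq = begin
    ∑[ α ← upTo (k + g) ] ⟦ not (α + g <ᵇ k + g) ⟧
      ≡⟨ ∑-upTo-+ k g _ ⟩
    ∑[ α ← upTo k ] ⟦ not (α + g <ᵇ k + g) ⟧ + ∑[ α ← upTo g ] ⟦ not (k + α + g <ᵇ k + g) ⟧
      ≤⟨ +-mono-≤ (≤-reflexive (trans (∑-upTo-cong k λ α α<k → cong (⟦_⟧ ∘ not) (Equivalence.to T-≡ (<⇒<ᵇ (+-monoˡ-< g α<k)))) (∑-zero (upTo k))))
                  (∑-mono (upTo g) λ α → ⟦⟧≤1 (not (k + α + g <ᵇ k + g))) ⟩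
    0 + ∑[ α ← upTo g ] 1
      ≡⟨ trans (∑-upTo-const g 1) (*-identityʳ g) ⟩
    g ∎
    where open ≤-Reasoning

  module LevelSets (h : ℕ) (𝕁 : ℕ → Bool) (L r : ℕ) .{{_ : NonZero L}} (r<L : r < L)
    .{{_ : NonZero (suc h * L + r)}} (p-prime : Prime (suc h * L + r)) (2<p : 2 < suc h * L + r) where

    open Convolution h 𝕁 using (M; N)
    open Blocks h 𝕁 L r r<L
    open Modular p
    open Equidistribution p p-prime 2<p

    -- S₀ with its gaps and the numbers from M L to p filled in.
    S₁ : ℕ → Bool
    S₁ a = not (a / L <ᵇ M) ∨ 𝕁 (a / L)

    -- `S₀` is the set that the block count controls and `S₁` the one that reaches density 1/2.
    -- Their difference has a number of residues bounded in terms of `M` and `r` and independent of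
    -- `L`, so it is negligible for large `p`.
    surplus : ℕ → Bool
    surplus a = S₁ a ∧ not (S₀ a)

    A₁ : ∀ {n} → 𝒫 p n
    A₁ x = S₁ (Q x % p)

    in-range : ∀ i α → i < M → α < L → ((i * L + α) / L <ᵇ M) ≡ true
    in-range i α i<M α<L = Equivalence.to T-≡ (<⇒<ᵇ (subst (_< M) (sym ([k*n+m]/n≡k i L α α<L)) i<M))

    ∑-surplus : ∑[ a ← upTo p ] ⟦ surplus a ⟧ ≤ M * (3 * r) + r
    ∑-surplus = begin
      ∑[ a ← upTo p ] ⟦ surplus a ⟧
        ≡⟨ ∑-blocks (⟦_⟧ ∘ surplus) ⟩
      ∑[ i ← upTo M ] ∑[ α ← upTo L ] ⟦ surplus (i * L + α) ⟧ + ∑[ ρ ← upTo r ] ⟦ surplus (M * L + ρ) ⟧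
        ≤⟨ +-mono-≤ (∑-upTo-mono M λ i i<M → ≤-trans (∑-upTo-mono L λ α α<L → surplus≤ i α i<M α<L) (∑-top L (3 * r)))
                    (∑-mono (upTo r) λ ρ → ⟦⟧≤1 (surplus (M * L + ρ))) ⟩
      ∑[ i ← upTo M ] (3 * r) + ∑[ ρ ← upTo r ] 1
        ≡⟨ cong₂ _+_ (∑-upTo-const M (3 * r)) (trans (∑-upTo-const r 1) (*-identityʳ r)) ⟩
      M * (3 * r) + r ∎
      where
      open ≤-Reasoning
      bool : ∀ u j w → u ≡ true → ⟦ (not u ∨ j) ∧ not (u ∧ (j ∧ w)) ⟧ ≤ ⟦ not w ⟧
      bool true false w refl = z≤n
      bool true true  w refl = ≤-refl
      surplus≤ : ∀ i α → i < M → α < L → ⟦ surplus (i * L + α) ⟧ ≤ ⟦ not (α + 3 * r <ᵇ L) ⟧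
      surplus≤ i α i<M α<L = subst (λ z → ⟦ surplus (i * L + α) ⟧ ≤ ⟦ not (z + 3 * r <ᵇ L) ⟧) ([k*n+m]%n≡m i L α α<L)
        (bool ((i * L + α) / L <ᵇ M) (𝕁 ((i * L + α) / L)) _ (in-range i α i<M α<L))

    ∑-not-S₁ : ∑[ a ← upTo p ] ⟦ not (S₁ a) ⟧ ≡ ∑[ i ← upTo M ] ⟦ not (𝕁 i) ⟧ * L
    ∑-not-S₁ = begin
      ∑[ a ← upTo p ] ⟦ not (S₁ a) ⟧
        ≡⟨ ∑-blocks (⟦_⟧ ∘ not ∘ S₁) ⟩
      ∑[ i ← upTo M ] ∑[ α ← upTo L ] ⟦ not (S₁ (i * L + α)) ⟧ + ∑[ ρ ← upTo r ] ⟦ not (S₁ (M * L + ρ)) ⟧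
        ≡⟨ cong₂ _+_ (∑-upTo-cong M λ i i<M → trans (∑-upTo-cong L λ α α<L → inside i α i<M α<L)
                        (trans (∑-upTo-const L _) (*-comm L _)))
                     (trans (∑-cong (upTo r) outside) (∑-zero (upTo r))) ⟩
      ∑[ i ← upTo M ] (⟦ not (𝕁 i) ⟧ * L) + 0
        ≡⟨ trans (+-identityʳ _) (∑-*ʳ (upTo M) (λ i → ⟦ not (𝕁 i) ⟧) L) ⟩
      ∑[ i ← upTo M ] ⟦ not (𝕁 i) ⟧ * L ∎
      where
      open ≡-Reasoning
      inside : ∀ i α → i < M → α < L → ⟦ not (S₁ (i * L + α)) ⟧ ≡ ⟦ not (𝕁 i) ⟧
      inside i α i<M α<L = cong₂ (λ u k → ⟦ not (not u ∨ 𝕁 k) ⟧) (in-range i α i<M α<L) ([k*n+m]/n≡k i L α α<L)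
      outside : ∀ ρ → ⟦ not (S₁ (M * L + ρ)) ⟧ ≡ 0
      outside ρ with (M * L + ρ) / L <ᵇ M in eq
      ... | false = refl
      ... | true  = contradiction (<ᵇ⇒< _ _ (subst T (sym eq) _))
        (≤⇒≯ (≤-trans (≤-reflexive (sym (m*n/n≡m M L))) (/-monoˡ-≤ L (m≤m+n (M * L) ρ))))

    shift : ∀ {n} → 𝔽^ p n → ℕ
    shift d = (2 * Q d) % p

    shift-2· : ∀ {n} (d : 𝔽^ p n) → shift (2 · d) ≡ (4 * shift d) % p
    shift-2· d = %-≡ (≋-trans (*-≋ {a = 2} ≋-refl (Q-· 2 d)) (≋-trans (≡⇒≋ (rearrange (Q d))) (*-≋ {a = 4} ≋-refl (≋-sym (%-≋ (2 * Q d))))))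
      where
      rearrange : ∀ q → 2 * (2 * 2 * q) ≡ 4 * (2 * q)
      rearrange = solve-∀

    -- After adding `Q x` to both sides, the representative of its negative inside `third` cancels,
    -- and what remains is `Q-second-difference`.
    third-term : ∀ {n} (x d : 𝔽^ p n) → Q (x ⊕ 2 · d) % p ≡ third (shift d) (m%n<n _ p) (Q x % p) (Q (x ⊕ d) % p)
    third-term x d = %-≡ (≋-cancelʳ (Q x) (≋-trans (Q-second-difference x d) (≋-sym
      (≋-trans (+-≋ {a = 2 * (Q (x ⊕ d) % p) + shift d + (p ∸ Q x % p)} ≋-refl (≋-sym (%-≋ (Q x))))
      (≋-trans (≡⇒≋ (trans (+-assoc (2 * (Q (x ⊕ d) % p) + shift d) _ _) (cong (2 * (Q (x ⊕ d) % p) + shift d +_) (m∸n+n≡m (<⇒≤ (m%n<n (Q x) p))))))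
      (≋-trans (mod≡ ([m+n]%n≡m%n (2 * (Q (x ⊕ d) % p) + shift d) p))
        (+-≋ (*-≋ {a = 2} ≋-refl (%-≋ _)) (%-≋ _))))))))

    A₀ : ∀ {n} → 𝒫 p n
    A₀ x = S₀ (Q x % p)

    module _ (m : ℕ) (d : 𝔽^ p (4 + m)) (d≢0 : is-zero d ≡ false) where

      private pts = points p (4 + m)

      progressions-A₀ : ∀ C → (∀ v → v ≤ 4 → N (shift d / L + v) ≤ C) →
        progressions A₀ d ≤ p ^ (2 + m) * (L * (L * C) + 2 * p)
      progressions-A₀ C good = begin
        progressions A₀ d
          ≡⟨ ∑-cong pts (λ x → cong (λ c → ⟦ A₀ x ∧ (A₀ (x ⊕ d) ∧ S₀ c) ⟧) (third-term x d)) ⟩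
        ∑[ x ← pts ] ⟦ F (Q x % p) (Q (x ⊕ d) % p) ⟧
          ≤⟨ equidistributed m d d≢0 F ⟩
        p ^ (2 + m) * (∑∑ d (λ a b → ⟦ F a b ⟧) + 2 * p)
          ≡⟨ cong (λ z → p ^ (2 + m) * (z + 2 * p)) (∑-cong (upTo p) λ a → trans (∑-cong (upTo p) λ b →
               trans (⟦∧⟧ (S₀ a) _) (cong (⟦ S₀ a ⟧ *_) (⟦∧⟧ (S₀ b) _))) (∑-*ˡ (upTo p) ⟦ S₀ a ⟧ _)) ⟩
        p ^ (2 + m) * (S₀-progressions (shift d) (m%n<n _ p) + 2 * p)
          ≤⟨ *-monoʳ-≤ (p ^ (2 + m)) (+-monoˡ-≤ (2 * p) (S₀-progressions≤ (shift d) (m%n<n _ p) C good)) ⟩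
        p ^ (2 + m) * (L * (L * C) + 2 * p) ∎
        where
        open ≤-Reasoning
        F : ℕ → ℕ → Bool
        F a b = S₀ a ∧ (S₀ b ∧ S₀ (third (shift d) (m%n<n _ p) a b))

      -- The 8 collects four equidistribution errors `2 * p`: one from `A₀`, and one from each of
      -- the three terms that may lie in the surplus.
      progressions-A₁ : ∀ C → (∀ v → v ≤ 4 → N (shift d / L + v) ≤ C) →
        progressions A₁ d ≤ p ^ (2 + m) * (L * (L * C) + p * (8 + 3 * (M * (3 * r) + r)))
      progressions-A₁ C good = begin
        progressions A₁ d
          ≤⟨ ∑-mono pts (λ x → three-terms (A₁ x) (A₁ (x ⊕ d)) (A₁ (x ⊕ 2 · d)) (A₀ x) (A₀ (x ⊕ d)) (A₀ (x ⊕ 2 · d))) ⟩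
        ∑[ x ← pts ] (⟦ A₀ x ∧ (A₀ (x ⊕ d) ∧ A₀ (x ⊕ 2 · d)) ⟧ + (D x + (D (x ⊕ d) + D (x ⊕ 2 · d))))
          ≡⟨ trans (∑-+ pts _ _) (cong (progressions A₀ d +_) (trans (∑-+ pts _ _) (cong₂ _+_ refl (trans (∑-+ pts _ _)
               (cong₂ _+_ (∑-translateʳ (4 + m) D d) (∑-translateʳ (4 + m) D (2 · d))))))) ⟩
        progressions A₀ d + (∑ pts D + (∑ pts D + ∑ pts D))
          ≤⟨ +-mono-≤ (progressions-A₀ C good) (+-mono-≤ ∑D≤ (+-mono-≤ ∑D≤ ∑D≤)) ⟩
        P * (L * (L * C) + 2 * p) + (P * (p * E + 2 * p) + (P * (p * E + 2 * p) + P * (p * E + 2 * p)))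
          ≡⟨ rearrange P (L * (L * C)) p E ⟩
        P * (L * (L * C) + p * (8 + 3 * E)) ∎
        where
        open ≤-Reasoning
        P = p ^ (2 + m)
        E = M * (3 * r) + r
        D : 𝔽^ p (4 + m) → ℕ
        D x = ⟦ surplus (Q x % p) ⟧
        ∑D≤ : ∑ pts D ≤ P * (p * E + 2 * p)
        ∑D≤ = ≤-trans (distribution m d d≢0 surplus) (*-monoʳ-≤ P (+-monoˡ-≤ (2 * p) (*-monoʳ-≤ p ∑-surplus)))
        rearrange : ∀ P T p E → P * (T + 2 * p) + (P * (p * E + 2 * p) + (P * (p * E + 2 * p) + P * (p * E + 2 * p))) ≡
          P * (T + p * (8 + 3 * E))
        rearrange = solve-∀

      ∑-not-A₁ : ∑[ x ← pts ] ⟦ not (A₁ x) ⟧ ≤ p ^ (2 + m) * (p * (∑[ i ← upTo M ] ⟦ not (𝕁 i) ⟧ * L) + 2 * p)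
      ∑-not-A₁ = ≤-trans (distribution m d d≢0 (not ∘ S₁)) (≤-reflexive (cong (λ z → p ^ (2 + m) * (p * z + 2 * p)) ∑-not-S₁))

  import Data.Fin.Properties as Fin

  -- Subsets of prescribed size

  ∑-cong-All : {X : Set} {xs : List X} {f g : X → ℕ} → All (λ x → f x ≡ g x) xs → ∑ xs f ≡ ∑ xs g
  ∑-cong-All []       = refl
  ∑-cong-All (e ∷ es) = cong₂ _+_ e (∑-cong-All es)

  -- Greedy choice: the first `k` members of `A` on the list are kept. Uniqueness guarantees that
  -- adding the head to `B` does not change the count on the tail.
  trim : {X : Set} → DecidableEquality X → (A : X → Bool) → ∀ {xs} → Unique xs → ∀ k → k ≤ ∑[ x ← xs ] ⟦ A x ⟧ →
    Σ[ B ∈ (X → Bool) ] (∀ x → T (B x) → T (A x)) × ∑[ x ← xs ] ⟦ B x ⟧ ≡ k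
  trim _≟ᵛ_ A {xs} uniq zero k≤ = (λ _ → false) , (λ _ ()) , ∑-zero xs
  trim _≟ᵛ_ A {x ∷ xs} (x∉ ∷ uniq) (suc k) k≤ with A x in Ax
  ... | false with B , B⊆A , size ← trim _≟ᵛ_ A uniq (suc k) k≤ = B , B⊆A , trans (cong (_+ ∑[ y ← xs ] ⟦ B y ⟧) x∉B) size
    where
    x∉B : ⟦ B x ⟧ ≡ 0
    x∉B with B x in Bx
    ... | false = refl
    ... | true with () ← subst T Ax (B⊆A x (subst T (sym Bx) _))
  ... | true with B , B⊆A , size ← trim _≟ᵛ_ A uniq k (s≤s⁻¹ k≤) = B′ , B′⊆A , cong₂ _+_ x∈B′ (trans (∑-cong-All (All.map unchanged x∉)) size)
    where
    B′ : _ → Bool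
    B′ y = does (y ≟ᵛ x) ∨ B y
    B′⊆A : ∀ y → T (B′ y) → T (A y)
    B′⊆A y y∈ with y ≟ᵛ x
    ... | yes refl = subst T (sym Ax) _
    ... | no _     = B⊆A y y∈
    x∈B′ : ⟦ B′ x ⟧ ≡ 1
    x∈B′ with x ≟ᵛ x
    ... | yes _  = refl
    ... | no x≢x = contradiction refl x≢x
    unchanged : ∀ {y} → x ≢ y → ⟦ B′ y ⟧ ≡ ⟦ B y ⟧
    unchanged {y} x≢y with y ≟ᵛ x
    ... | yes y≡x = contradiction (sym y≡x) x≢y
    ... | no _    = refl

  points-unique : ∀ p n → Unique (points p n)
  points-unique p zero    = [] ∷ []
  points-unique p (suc n) = cartesianProductWith⁺ _∷_ ∷-injective (allFin⁺ p) (points-unique p n)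

  trim-set : ∀ {p n} (A : 𝒫 p n) k → k ≤ ∑[ x ← points p n ] ⟦ A x ⟧ →
    Σ[ B ∈ 𝒫 p n ] (∀ x → T (B x) → T (A x)) × card B ≡ k
  trim-set {p} {n} A k k≤ with B , B⊆A , size ← trim (≡-dec Fin._≟_) A (points-unique p n) k k≤ =
    B , B⊆A , trans (length-filterᵇ B (points p n)) size

  progressions-mono : ∀ {p n} .{{_ : NonZero p}} {A B : 𝒫 p n} → (∀ x → T (B x) → T (A x)) →
    ∀ d → progressions B d ≤ progressions A d
  progressions-mono {p} {n} {B = B} B⊆A d = ∑-mono (points p n) λ x → T⟦⟧≤ λ s →
    let u , v = Equivalence.to (T-∧ {B x}) s ; v , w = Equivalence.to (T-∧ {B (x ⊕ d)}) v
    in Equivalence.from T-∧ (B⊆A _ u , Equivalence.from T-∧ (B⊆A _ v , B⊆A _ w))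

  unit : ∀ {p} .{{_ : NonZero p}} n → 𝔽^ p (suc n)
  unit n = 1 mod _ ∷ 𝟎

  unit≢𝟎 : ∀ {p} .{{_ : NonZero p}} → 1 < p → ∀ n → unit n ≢ 𝟎 {p}
  unit≢𝟎 {p} 1<p n eq = contradiction 1≡0 λ ()
    where
    open Modular p
    1≡0 : 1 ≡ 0
    1≡0 = ≋⇒≡ 1<p (<-trans z<s 1<p) (mod≡ (trans (sym (toℕ-mod 1))
      (trans (cong toℕ (proj₁ (∷-injective eq))) (toℕ-mod 0))))

  m≤2*n⇒m/2≤n : ∀ {m n} → m ≤ 2 * n → m / 2 ≤ n
  m≤2*n⇒m/2≤n {m} {n} m≤2n = ≤-trans (/-monoˡ-≤ 2 m≤2n) (≤-reflexive (trans (cong (_/ 2) (*-comm 2 n)) (m*n/n≡m n 2)))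

  -- The sets

  module Construction (h : ℕ) (𝕁 : ℕ → Bool) (C a b : ℕ)
    (N≤C : ∀ w → w < a + 4 ⊎ (b ≤ w × w < suc h + 5) → Convolution.N h 𝕁 w ≤ C)
    (a<M : a < suc h) (b+M<4a : b + suc (suc h) ≤ 4 * a) (4b≤2M+a : 4 * b ≤ 2 * suc h + a)
    (half : 2 * ∑[ i ← upTo (suc h) ] ⟦ not (𝕁 i) ⟧ ≤ suc h) where

    open Convolution h 𝕁 using (M; N)

    -- The inequality I₃ ≤ (C + 1) / M² without denominators. The extra 1 pays for all error terms.
    Unpopular : ∀ {p n} .{{_ : NonZero p}} → 𝒫 p n → 𝔽^ p n → Set
    Unpopular {p} {n} A d = M * M * progressions A d ≤ suc C * p ^ n

    module _ (L r : ℕ) .{{_ : NonZero L}} (r<L : r < L) (4≤r : 4 ≤ r)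
      .{{_ : NonZero (M * L + r)}} (p-prime : Prime (M * L + r)) (2<p : 2 < M * L + r) where

      open Blocks h 𝕁 L r r<L using (p)
      open Modular p
      open Equidistribution p p-prime 2<p using (2·-nonzero)
      open LevelSets h 𝕁 L r r<L p-prime 2<p

      bound : ℕ → ℕ
      bound m = p ^ (2 + m) * (L * (L * C) + p * (8 + 3 * (M * (3 * r) + r)))

      block<M+1 : ∀ s → s < p → s / L < suc M
      block<M+1 s s<p = m<n*o⇒m/o<n (<-trans s<p (≤-trans (+-monoʳ-< (M * L) r<L) (≤-reflexive (+-comm (M * L) L))))

      -- A shift may lie in the incomplete block `M` beyond `M * L`, so `s / L + v` can be as large
      -- as `M + 4`.
      good-shift : ∀ s → s < p → s / L < a ⊎ b ≤ s / L → ∀ v → v ≤ 4 → N (s / L + v) ≤ C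
      good-shift s s<p (inj₁ t<a) v v≤4 = N≤C _ (inj₁ (+-mono-<-≤ t<a v≤4))
      good-shift s s<p (inj₂ b≤t) v v≤4 = N≤C _ (inj₂ (≤-trans b≤t (m≤m+n _ v) ,
        ≤-trans (s≤s (+-mono-≤ (s≤s⁻¹ (block<M+1 s s<p)) v≤4)) (≤-reflexive (sym (+-suc M 4)))))

      popular-fails : ∀ m (d : 𝔽^ p (4 + m)) → is-zero d ≡ false →
        progressions A₁ d ≤ bound m ⊎ progressions A₁ (2 · d) ≤ bound m
      popular-fails m d d≢0 with far-from-half M a b L r (shift d) r<L a<M b+M<4a 4b≤2M+a
      ... | inj₁ far = inj₁ (progressions-A₁ m d d≢0 C (good-shift (shift d) (m%n<n _ p) far))
      ... | inj₂ far = inj₂ (progressions-A₁ m (2 · d) (2·-nonzero d d≢0) C (good-shift (shift (2 · d)) (m%n<n _ p)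
        (subst (λ s → s / L < a ⊎ b ≤ s / L) (sym (shift-2· d)) far)))

      -- Twice the equidistribution error of the complement amounts to 4 residues. All `r` residues
      -- from `M * L` on belong to `S₁`, and since `4 ≤ r` they make up for it.
      p^n≤2∣A₁∣ : ∀ m → p ^ (4 + m) ≤ 2 * ∑[ x ← points p (4 + m) ] ⟦ A₁ x ⟧
      p^n≤2∣A₁∣ m = +-cancelʳ-≤ (2 * out) _ _ (begin
        p ^ (4 + m) + 2 * out
          ≤⟨ +-monoʳ-≤ (p ^ (4 + m)) 2out≤ ⟩
        p ^ (4 + m) + p ^ (4 + m)
          ≡⟨ cong (λ z → p ^ (4 + m) + z) (+-identityʳ (p ^ (4 + m))) ⟨
        2 * p ^ (4 + m)
          ≡⟨ cong (2 *_) (trans (∑-not A₁ pts) (length-points p (4 + m))) ⟨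
        2 * (∑[ x ← pts ] ⟦ A₁ x ⟧ + out)
          ≡⟨ *-distribˡ-+ 2 (∑[ x ← pts ] ⟦ A₁ x ⟧) out ⟩
        2 * ∑[ x ← pts ] ⟦ A₁ x ⟧ + 2 * out ∎)
        where
        open ≤-Reasoning
        pts = points p (4 + m)
        out = ∑[ x ← pts ] ⟦ not (A₁ x) ⟧
        O = ∑[ i ← upTo M ] ⟦ not (𝕁 i) ⟧
        P = p ^ (2 + m)
        rearrange : ∀ P p O L → 2 * (P * (p * (O * L) + 2 * p)) ≡ p * (p * 0 + (2 * O * L + 4)) * P
        rearrange = solve-∀
        rearrange′ : ∀ P p z → p * (p * 0 + z) * P ≡ z * (p * P)
        rearrange′ = solve-∀
        2out≤ : 2 * out ≤ p ^ (4 + m)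
        2out≤ = begin
          -- The unit vector supplies the nonzero `d` that equidistribution asks for.
          2 * out                               ≤⟨ *-monoʳ-≤ 2 (∑-not-A₁ m (unit (3 + m)) (≢𝟎⇒is-zero _ (unit≢𝟎 (<-trans (s<s z<s) 2<p) (3 + m)))) ⟩
          2 * (P * (p * (O * L) + 2 * p))       ≡⟨ trans (rearrange P p O L) (rearrange′ P p (2 * O * L + 4)) ⟩
          (2 * O * L + 4) * (p * P)             ≤⟨ *-monoˡ-≤ (p * P) (+-mono-≤ (*-monoˡ-≤ L half) 4≤r) ⟩
          p * (p * P)                           ∎

      -- In units of p ^ n / M², the main term is at most `C` because `M * L ≤ p`, and the error is
      -- at most 1 because `M * M * E ≤ p`.
      bound≤ : ∀ m E → 8 + 3 * (M * (3 * r) + r) ≤ E → M * M * E ≤ p → M * M * bound m ≤ suc C * p ^ (4 + m)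
      bound≤ m E r≤ p≥ = begin
        M * M * (P * (L * (L * C) + p * (8 + 3 * (M * (3 * r) + r))))
          ≤⟨ *-monoʳ-≤ (M * M) (*-monoʳ-≤ P (+-monoʳ-≤ (L * (L * C)) (*-monoʳ-≤ p r≤))) ⟩
        M * M * (P * (L * (L * C) + p * E))
          ≡⟨ rearrange₁ M L C P p E ⟩
        P * ((M * L) * (M * L) * C + p * (M * M * E))
          ≤⟨ *-monoʳ-≤ P (+-mono-≤ (*-monoˡ-≤ C (*-mono-≤ ML≤p ML≤p)) (*-monoʳ-≤ p p≥)) ⟩
        P * (p * p * C + p * p)
          ≡⟨ rearrange₂ P p C ⟩
        suc C * (p * (p * P)) ∎
        where
        open ≤-Reasoning
        P = p ^ (2 + m)
        ML≤p : M * L ≤ p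
        ML≤p = m≤m+n (M * L) r
        rearrange₁ : ∀ M L C P p E → M * M * (P * (L * (L * C) + p * E)) ≡ P * ((M * L) * (M * L) * C + p * (M * M * E))
        rearrange₁ = solve-∀
        rearrange₂ : ∀ P p C → P * (p * p * C + p * p) ≡ suc C * (p * (p * P))
        rearrange₂ = solve-∀

      trimmed : ∀ E → 8 + 3 * (M * (3 * r) + r) ≤ E → M * M * E ≤ p → ∀ m →
        Σ[ A ∈ 𝒫 p (4 + m) ] card A ≡ p ^ (4 + m) / 2 × (∀ d → d ≢ 𝟎 → Unpopular A d ⊎ Unpopular A (2 · d))
      trimmed E r≤ p≥ m
        with A , A⊆A₁ , size ← trim-set A₁ (p ^ (4 + m) / 2) (m≤2*n⇒m/2≤n (p^n≤2∣A₁∣ m))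
        = A , size , unpopular
        where
        unpopular : ∀ d → d ≢ 𝟎 → Unpopular A d ⊎ Unpopular A (2 · d)
        unpopular d d≢𝟎 with popular-fails m d (≢𝟎⇒is-zero d d≢𝟎)
        ... | inj₁ few = inj₁ (≤-trans (*-monoʳ-≤ (M * M) (≤-trans (progressions-mono A⊆A₁ d) few)) (bound≤ m E r≤ p≥))
        ... | inj₂ few = inj₂ (≤-trans (*-monoʳ-≤ (M * M) (≤-trans (progressions-mono A⊆A₁ (2 · d)) few)) (bound≤ m E r≤ p≥))

    -- The preceding modules have `M * L + r` itself as modulus; matching on the equation carries
    -- their result over to a given prime.
    unpopular-sets : ∀ p .{{_ : NonZero p}} → Prime p → ∀ L r → p ≡ M * L + r → r < L → 4 ≤ r →
      ∀ E → 8 + 3 * (M * (3 * r) + r) ≤ E → M * M * E ≤ p → ∀ m →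
      Σ[ A ∈ 𝒫 p (4 + m) ] card A ≡ p ^ (4 + m) / 2 × (∀ d → d ≢ 𝟎 → Unpopular A d ⊎ Unpopular A (2 · d))
    unpopular-sets .(M * L + r) p-prime L r refl r<L 4≤r = trimmed L r {{>-nonZero (≤-<-trans z≤n r<L)}} r<L 4≤r p-prime
      (≤-trans (≤-trans (m≤m+n 3 1) 4≤r) (m≤n+m r (M * L)))

open Counting

open import Data.Bool.Base using (true; false; _∧_; if_then_else_)
import Data.Fin.Properties as Fin
open import Data.Integer.Base as ℤ using (+_; -[1+_]; +≤+; +<+)
import Data.Integer.Properties as ℤ
open import Data.List.Base using (List; []; _∷_; map; foldr)
open import Data.List.Membership.Propositional using (_∈_)
open import Data.List.Relation.Unary.Any using (here; there)
open import Data.Nat.Base as ℕ using (ℕ; zero; suc; NonZero; _^_; z≤n; s≤s)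
open import Data.Nat.DivMod using (m≡m%n+[m/n]*n; m%n<n; m*n/n≡m; m/n*n≤m; /-monoˡ-≤)
open import Data.Nat.Primality using (Prime)
import Data.Nat.Properties as ℕ
open import Data.Nat.Tactic.RingSolver using (solve-∀)
open import Data.Product.Base using (Σ-syntax; ∃-syntax; _×_; _,_; proj₁; proj₂)
open import Data.Rational.Base as ℚ using (ℚ; 0ℚ; 1ℚ; ½; mkℚ; _/_; _+_; _*_; _-_; -_; _<_; _≤_; _⊓_; ∣_∣; toℚᵘ; *<*)
open import Data.Rational.Properties as ℚ using (toℚᵘ-injective; toℚᵘ-fromℚᵘ; toℚᵘ-homo-+; toℚᵘ-homo-*; toℚᵘ-cancel-≤; toℚᵘ-cancel-<)
open import Data.Rational.Unnormalised.Base as ℚᵘ using (mkℚᵘ; *≡*; *≤*; *<*)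
import Data.Rational.Unnormalised.Properties as ℚᵘ
open import Data.Sum.Base using (_⊎_; inj₁; inj₂)
open import Data.Vec.Properties using (≡-dec)
open import Relation.Binary.PropositionalEquality
open import Relation.Nullary using (yes; no; contradiction; ¬?)
open import Relation.Nullary.Decidable using (from-yes)
open import Relation.Unary using (Decidable)
open import Algebra.Properties.AbelianGroup ℚ.+-0-abelianGroup using (xyx⁻¹≈y)
open import Algebra.Properties.Group ℚ.+-0-group using (⁻¹-anti-homo-//)

import Data.Fin.Properties as Fin
import Data.Integer.Properties as ℤ
import Data.Nat.Properties as ℕ
import Data.Rational.Unnormalised.Properties as ℚᵘ

-- Rational values of the counts

toℚᵘ-/ : ∀ k n .{{_ : NonZero n}} → toℚᵘ (+ k / n) ℚᵘ.≃ (+ k ℚᵘ./ n)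
toℚᵘ-/ k (suc n) = toℚᵘ-fromℚᵘ (mkℚᵘ (+ k) n)

+-/1 : ∀ a b → + a / 1 + + b / 1 ≡ + (a ℕ.+ b) / 1
+-/1 a b = toℚᵘ-injective (begin
  toℚᵘ (+ a / 1 + + b / 1)                ≈⟨ toℚᵘ-homo-+ (+ a / 1) (+ b / 1) ⟩
  toℚᵘ (+ a / 1) ℚᵘ.+ toℚᵘ (+ b / 1)      ≈⟨ ℚᵘ.+-cong (toℚᵘ-/ a 1) (toℚᵘ-/ b 1) ⟩
  mkℚᵘ (+ a) 0 ℚᵘ.+ mkℚᵘ (+ b) 0          ≈⟨ *≡* (cong (ℤ._* + 1) (cong₂ ℤ._+_ (ℤ.*-identityʳ (+ a)) (ℤ.*-identityʳ (+ b)))) ⟩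
  mkℚᵘ (+ (a ℕ.+ b)) 0                    ≈⟨ toℚᵘ-/ (a ℕ.+ b) 1 ⟨
  toℚᵘ (+ (a ℕ.+ b) / 1)                  ∎)
  where open import Relation.Binary.Reasoning.Setoid ℚᵘ.≃-setoid

sum-of-counts : ∀ {X : Set} (xs : List X) (f : X → ℚ) (g : X → ℕ) → (∀ x → f x ≡ + g x / 1) →
  foldr _+_ 0ℚ (map f xs) ≡ + ∑ xs g / 1
sum-of-counts []       f g h = refl
sum-of-counts (x ∷ xs) f g h = trans (cong₂ _+_ (h x) (sum-of-counts xs f g h)) (+-/1 (g x) (∑ xs g))

𝟏-product : ∀ a b c → (if a then 1ℚ else 0ℚ) * (if b then 1ℚ else 0ℚ) * (if c then 1ℚ else 0ℚ) ≡ + ⟦ a ∧ (b ∧ c) ⟧ / 1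
𝟏-product true  true  true  = refl
𝟏-product true  true  false = refl
𝟏-product true  false true  = refl
𝟏-product true  false false = refl
𝟏-product false true  true  = refl
𝟏-product false true  false = refl
𝟏-product false false true  = refl
𝟏-product false false false = refl

1/n*k≤a/b : ∀ n k a b .{{_ : NonZero n}} .{{_ : NonZero b}} → b ℕ.* k ℕ.≤ a ℕ.* n →
  + 1 / n * (+ k / 1) ≤ + a / b
1/n*k≤a/b n@(suc n-1) k a b@(suc b-1) bk≤an = toℚᵘ-cancel-≤ (begin
  toℚᵘ (+ 1 / n * (+ k / 1))            ≃⟨ toℚᵘ-homo-* (+ 1 / n) (+ k / 1) ⟩
  toℚᵘ (+ 1 / n) ℚᵘ.* toℚᵘ (+ k / 1)    ≃⟨ ℚᵘ.*-cong (toℚᵘ-/ 1 n) (toℚᵘ-/ k 1) ⟩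
  mkℚᵘ (+ 1) n-1 ℚᵘ.* mkℚᵘ (+ k) 0      ≤⟨ *≤* (subst₂ ℤ._≤_ lhs rhs (+≤+ bk≤an)) ⟩
  mkℚᵘ (+ a) b-1                        ≃⟨ toℚᵘ-/ a b ⟨
  toℚᵘ (+ a / b)                        ∎)
  where
  open ℚᵘ.≤-Reasoning
  lhs : + (b ℕ.* k) ≡ + 1 ℤ.* + k ℤ.* + b
  lhs = trans (cong +_ (ℕ.*-comm b k)) (trans (ℤ.pos-* k b) (cong (ℤ._* + b) (sym (ℤ.*-identityˡ (+ k)))))
  rhs : + (a ℕ.* n) ≡ + a ℤ.* + (n ℕ.* 1)
  rhs = trans (cong (λ z → + (a ℕ.* z)) (sym (ℕ.*-identityʳ n))) (ℤ.pos-* a (n ℕ.* 1))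

I₃≤ : ∀ {p n} .{{_ : NonZero p}} (A : 𝒫 p n) d a b .{{_ : NonZero b}} →
  b ℕ.* progressions A d ℕ.≤ a ℕ.* p ^ n → I₃ (𝟏 A) d ≤ + a / b
I₃≤ {p} {n} A d a b h = subst (_≤ + a / b)
  (cong (_/_ (+ 1) (p ^ n) {{ℕ.m^n≢0 p n}} *_) (sym (sum-of-counts (points p n) _ _ λ x → 𝟏-product (A x) (A (x ⊕ d)) (A (x ⊕ 2 · d)))))
  (1/n*k≤a/b (p ^ n) (progressions A d) a b {{ℕ.m^n≢0 p n}} h)

-- The hypotheses say that `2 * k` is `n` or `n - 1`, so the deviation is at most 1 / (2 n). A
-- positive rational whose denominator is at most `n` is at least 1 / n.
half-close : ∀ n k .{{_ : NonZero n}} ε → 2 ℕ.* k ℕ.≤ n → n ℕ.< 2 ℕ.+ 2 ℕ.* k → 0ℚ < ε → ℚ.↧ₙ ε ℕ.≤ n →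
  ∣ + k / n - ½ ∣ < ε
half-close n k ε 2k≤n n<2+2k 0<ε q≤n = subst (_< ε) abs close
  where
  x = + k / n
  x≤½ : x ≤ ½
  x≤½ = toℚᵘ-cancel-≤ (ℚᵘ.≤-respˡ-≃ (ℚᵘ.≃-sym (toℚᵘ-/ k n)) (lemma n k 2k≤n))
    where
    lemma : ∀ n k .{{_ : NonZero n}} → 2 ℕ.* k ℕ.≤ n → (+ k ℚᵘ./ n) ℚᵘ.≤ mkℚᵘ (+ 1) 1
    lemma (suc n) k h = *≤* (subst₂ ℤ._≤_ (trans (cong +_ (ℕ.*-comm 2 k)) (ℤ.pos-* k 2)) (sym (ℤ.*-identityˡ (+ suc n))) (+≤+ h))
  ½<x+ε : ½ < x + ε
  ½<x+ε = toℚᵘ-cancel-< (ℚᵘ.<-respʳ-≃ (ℚᵘ.≃-sym (ℚᵘ.≃-trans (toℚᵘ-homo-+ x ε) (ℚᵘ.+-cong (toℚᵘ-/ k n) ℚᵘ.≃-refl))) (lemma n k ε n<2+2k 0<ε q≤n))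
    where
    lemma : ∀ n k .{{_ : NonZero n}} ε → n ℕ.< 2 ℕ.+ 2 ℕ.* k → 0ℚ < ε → ℚ.↧ₙ ε ℕ.≤ n →
      mkℚᵘ (+ 1) 1 ℚᵘ.< (+ k ℚᵘ./ n) ℚᵘ.+ toℚᵘ ε
    lemma n′@(suc n) k (mkℚ (+ zero)  q-1 _) _ (*<* 0<0) _ = contradiction 0<0 λ { (+<+ ()) }
    lemma n′@(suc n) k (mkℚ -[1+ e ] q-1 _) _ (*<* ()) _
    lemma n′@(suc n) k (mkℚ (+ suc e) q-1 _) h _ q≤n = *<* (subst₂ ℤ._<_ (sym (ℤ.*-identityˡ (+ (n′ ℕ.* q)))) rhs (+<+ main))
      where
      q = suc q-1
      main : n′ ℕ.* q ℕ.< (k ℕ.* q ℕ.+ suc e ℕ.* n′) ℕ.* 2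
      main = begin-strict
        n′ ℕ.* q                               ≤⟨ ℕ.*-monoˡ-≤ q (ℕ.s≤s⁻¹ h) ⟩
        suc (2 ℕ.* k) ℕ.* q                    ≡⟨ rearrange k q ⟩
        k ℕ.* q ℕ.* 2 ℕ.+ q                    ≤⟨ ℕ.+-monoʳ-≤ (k ℕ.* q ℕ.* 2) q≤n ⟩
        k ℕ.* q ℕ.* 2 ℕ.+ n′                   <⟨ ℕ.+-monoʳ-< (k ℕ.* q ℕ.* 2) (ℕ.m<m+n n′ {n′} ℕ.z<s) ⟩
        k ℕ.* q ℕ.* 2 ℕ.+ (n′ ℕ.+ n′)          ≤⟨ ℕ.m≤m+n _ (e ℕ.* n′ ℕ.* 2) ⟩
        k ℕ.* q ℕ.* 2 ℕ.+ (n′ ℕ.+ n′) ℕ.+ e ℕ.* n′ ℕ.* 2 ≡⟨ rearrange′ k q n′ e ⟩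
        (k ℕ.* q ℕ.+ suc e ℕ.* n′) ℕ.* 2       ∎
        where
        open ℕ.≤-Reasoning
        rearrange : ∀ k q → suc (2 ℕ.* k) ℕ.* q ≡ k ℕ.* q ℕ.* 2 ℕ.+ q
        rearrange = solve-∀
        rearrange′ : ∀ k q n e → k ℕ.* q ℕ.* 2 ℕ.+ (n ℕ.+ n) ℕ.+ e ℕ.* n ℕ.* 2 ≡ (k ℕ.* q ℕ.+ suc e ℕ.* n) ℕ.* 2
        rearrange′ = solve-∀
      rhs : + ((k ℕ.* q ℕ.+ suc e ℕ.* n′) ℕ.* 2) ≡ (+ k ℤ.* + q ℤ.+ + suc e ℤ.* + n′) ℤ.* + 2
      rhs = trans (ℤ.pos-* (k ℕ.* q ℕ.+ suc e ℕ.* n′) 2) (cong (ℤ._* + 2)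
        (trans (ℤ.pos-+ (k ℕ.* q) _) (cong₂ ℤ._+_ (ℤ.pos-* k q) (ℤ.pos-* (suc e) n′))))
  close : ½ - x < ε
  close = subst (½ - x <_) (xyx⁻¹≈y x ε) (ℚ.+-monoˡ-< (- x) ½<x+ε)
  0≤½-x : 0ℚ ≤ ½ - x
  0≤½-x = subst (_≤ ½ - x) (ℚ.+-inverseʳ x) (ℚ.+-monoˡ-≤ (- x) x≤½)
  abs : ½ - x ≡ ∣ x - ½ ∣
  abs = begin
    ½ - x           ≡⟨ ℚ.0≤p⇒∣p∣≡p 0≤½-x ⟨
    ∣ ½ - x ∣       ≡⟨ ℚ.∣-p∣≡∣p∣ (½ - x) ⟨
    ∣ - (½ - x) ∣   ≡⟨ cong ∣_∣ (⁻¹-anti-homo-// ½ x) ⟩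
    ∣ x - ½ ∣       ∎
    where open ≡-Reasoning

-- Maxima over nonzero vectors and the limit of the densities

maximum : ∀ {X : Set} {P : X → Set} → Decidable P → (g : X → ℚ) → (xs : List X) → ∃[ x ] P x →
  ∃[ y ] P y × (∀ x → x ∈ xs → P x → g x ≤ g y)
maximum P? g []       (x₀ , Px₀) = x₀ , Px₀ , λ _ ()
maximum P? g (x ∷ xs) ∃P with y , Py , best ← maximum P? g xs ∃P | P? x
... | no ¬Px = y , Py , λ where
      z (here refl) Pz → contradiction Pz ¬Px
      z (there z∈)  Pz → best z z∈ Pz
... | yes Px with ℚ.≤-total (g x) (g y)
...   | inj₁ gx≤gy = y , Py , λ where
      z (here refl) Pz → gx≤gy
      z (there z∈)  Pz → best z z∈ Pz
...   | inj₂ gy≤gx = x , Px , λ where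
      z (here refl) Pz → ℚ.≤-refl
      z (there z∈)  Pz → ℚ.≤-trans (best z z∈ Pz) gy≤gx

max-over-nonzero : ∀ {p} .{{_ : NonZero p}} → 1 ℕ.< p → ∀ n (g : 𝔽^ p (suc n) → ℚ) →
  ∃[ d ] d ≢ 𝟎 × IsMaxOverNonzero g (g d)
max-over-nonzero {p} 1<p n g
  with d , d≢𝟎 , best ← maximum (λ x → ¬? (≡-dec Fin._≟_ x 𝟎)) g (points p (suc n)) (unit n , unit≢𝟎 1<p n)
  = d , d≢𝟎 , (d , d≢𝟎 , refl) , λ x x≢𝟎 → best x (∈-points x) x≢𝟎

n<p^n : ∀ p → 1 ℕ.< p → ∀ n → n ℕ.< p ^ n
n<p^n p 1<p zero    = ℕ.z<s
n<p^n p 1<p (suc n) = begin-strict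
  suc n           ≤⟨ n<p^n p 1<p n ⟩
  p ^ n           <⟨ ℕ.m<m+n (p ^ n) (ℕ.≤-<-trans z≤n (n<p^n p 1<p n)) ⟩
  p ^ n ℕ.+ p ^ n ≡⟨ cong (p ^ n ℕ.+_) (ℕ.+-identityʳ (p ^ n)) ⟨
  2 ℕ.* p ^ n     ≤⟨ ℕ.*-monoˡ-≤ (p ^ n) 1<p ⟩
  p ^ suc n       ∎
  where open ℕ.≤-Reasoning

density-half : ∀ p .{{_ : NonZero p}} → 1 ℕ.< p → (A : ∀ n → 𝒫 p n) →
  (∀ m → card (A (4 ℕ.+ m)) ≡ p ^ (4 ℕ.+ m) ℕ./ 2) → (λ n → density (A n)) ⟶ ½
-- As n < p ^ n, this makes `p ^ n` exceed the denominator of `ε`; the 4 restricts to the dimensions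
-- where `size` applies.
density-half p 1<p A size ε 0<ε = 4 ℕ.+ ℚ.↧ₙ ε , close
  where
  halves : ∀ N → N ℕ.< 2 ℕ.+ 2 ℕ.* (N ℕ./ 2)
  halves N = begin-strict
    N                               ≡⟨ m≡m%n+[m/n]*n N 2 ⟩
    N ℕ.% 2 ℕ.+ N ℕ./ 2 ℕ.* 2       <⟨ ℕ.+-mono-<-≤ (m%n<n N 2) (ℕ.≤-reflexive (ℕ.*-comm (N ℕ./ 2) 2)) ⟩
    2 ℕ.+ 2 ℕ.* (N ℕ./ 2)           ∎
    where open ℕ.≤-Reasoning
  close : ∀ n → 4 ℕ.+ ℚ.↧ₙ ε ℕ.≤ n → ∣ density (A n) - ½ ∣ < ε
  close n h with m , refl ← ℕ.m≤n⇒∃[o]m+o≡n (ℕ.≤-trans (ℕ.m≤m+n 4 (ℚ.↧ₙ ε)) h) =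
    half-close (p ^ (4 ℕ.+ m)) (card (A (4 ℕ.+ m))) {{ℕ.m^n≢0 p (4 ℕ.+ m)}} ε
      (ℕ.≤-trans (ℕ.≤-reflexive (trans (cong (2 ℕ.*_) (size m)) (ℕ.*-comm 2 (p ^ (4 ℕ.+ m) ℕ./ 2)))) (m/n*n≤m (p ^ (4 ℕ.+ m)) 2))
      (subst (λ k → p ^ (4 ℕ.+ m) ℕ.< 2 ℕ.+ 2 ℕ.* k) (sym (size m)) (halves (p ^ (4 ℕ.+ m))))
      0<ε
      (ℕ.≤-trans (ℕ.m+n≤o⇒n≤o 4 h) (ℕ.<⇒≤ (n<p^n p 1<p (4 ℕ.+ m))))

import Data.Nat.Properties as ℕ
import Data.Rational.Properties as ℚ

-- The numerical constants and the conclusion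

open Construction 359 𝕁 16184 145 216 N-bound (ℕ.m≤m+n 146 214) (ℕ.m≤m+n 577 3) (ℕ.m≤m+n 864 1)
  (ℕ.≤-reflexive (cong (2 ℕ.*_) ∑-𝕁)) using (unpopular-sets)

-- 129600 is 360², and 1177217 = 8 + 3 (360 · 3 · 363 + 363) is the error factor of
-- `progressions-A₁` for the largest remainder, r = 363.
p-threshold : ℕ
p-threshold = 129600 ℕ.* 1177217

unpopular-family : ∀ p .{{_ : NonZero p}} → Prime p → p-threshold ℕ.≤ p → ∀ m →
  Σ[ A ∈ 𝒫 p (4 ℕ.+ m) ] card A ≡ p ^ (4 ℕ.+ m) ℕ./ 2 ×
    (∀ d → d ≢ 𝟎 → 129600 ℕ.* progressions A d ℕ.≤ 16185 ℕ.* p ^ (4 ℕ.+ m)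
                 ⊎ 129600 ℕ.* progressions A (2 · d) ℕ.≤ 16185 ℕ.* p ^ (4 ℕ.+ m))
unpopular-family p p-prime p≥ = unpopular-sets p p-prime L r p≡ r<L (ℕ.m≤m+n 4 ρ) 1177217 error≤ p≥
  where
  -- Dividing p - 4 instead of p puts `r` between 4 and 363, as the density of `A₁` requires
  -- `4 ≤ r`.
  L = (p ℕ.∸ 4) ℕ./ 360
  ρ = (p ℕ.∸ 4) ℕ.% 360
  r = 4 ℕ.+ ρ
  r≤363 : r ℕ.≤ 363
  r≤363 = ℕ.+-monoʳ-≤ 4 (ℕ.s≤s⁻¹ (m%n<n (p ℕ.∸ 4) 360))
  131044≤p : 131044 ℕ.≤ p
  131044≤p = ℕ.≤-trans (ℕ.m≤m+n 131044 (p-threshold ℕ.∸ 131044)) p≥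
  p≡ : p ≡ 360 ℕ.* L ℕ.+ r
  p≡ = begin
    p                             ≡⟨ ℕ.m+[n∸m]≡n (ℕ.≤-trans (ℕ.m≤m+n 4 131040) 131044≤p) ⟨
    4 ℕ.+ (p ℕ.∸ 4)               ≡⟨ cong (4 ℕ.+_) (m≡m%n+[m/n]*n (p ℕ.∸ 4) 360) ⟩
    4 ℕ.+ (ρ ℕ.+ L ℕ.* 360)       ≡⟨ ℕ.+-assoc 4 ρ (L ℕ.* 360) ⟨
    r ℕ.+ L ℕ.* 360               ≡⟨ ℕ.+-comm r (L ℕ.* 360) ⟩
    L ℕ.* 360 ℕ.+ r               ≡⟨ cong (ℕ._+ r) (ℕ.*-comm L 360) ⟩
    360 ℕ.* L ℕ.+ r               ∎
    where open ≡-Reasoning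
  r<L : r ℕ.< L
  r<L = ℕ.≤-trans (s≤s r≤363) (ℕ.≤-trans (ℕ.≤-reflexive (sym (m*n/n≡m 364 360))) (/-monoˡ-≤ 360 (ℕ.∸-monoˡ-≤ 4 131044≤p)))
  error≤ : 8 ℕ.+ 3 ℕ.* (360 ℕ.* (3 ℕ.* r) ℕ.+ r) ℕ.≤ 1177217
  error≤ = ℕ.+-monoʳ-≤ 8 (ℕ.*-monoʳ-≤ 3 (ℕ.+-mono-≤ (ℕ.*-monoʳ-≤ 360 (ℕ.*-monoʳ-≤ 3 r≤363)) r≤363))

module Family (p : ℕ) .{{_ : NonZero p}} (1<p : 1 ℕ.< p) (C M : ℕ) .{{_ : NonZero M}}
  (family : ∀ m → Σ[ A ∈ 𝒫 p (4 ℕ.+ m) ] card A ≡ p ^ (4 ℕ.+ m) ℕ./ 2 ×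
    (∀ d → d ≢ 𝟎 → M ℕ.* progressions A d ℕ.≤ C ℕ.* p ^ (4 ℕ.+ m)
                 ⊎ M ℕ.* progressions A (2 · d) ℕ.≤ C ℕ.* p ^ (4 ℕ.+ m))) where

  -- The empty set is a default value in dimensions below 4, which the final choice `n₀ = 4`
  -- excludes.
  A : ∀ n → 𝒫 p n
  A (suc (suc (suc (suc m)))) = proj₁ (family m)
  A _                         = λ _ → false

  density-A : (λ n → density (A n)) ⟶ ½
  density-A = density-half p 1<p A (λ m → proj₁ (proj₂ (family m)))

  min-I₃ : ∀ n → 𝔽^ p n → ℚ
  min-I₃ n d = I₃ (𝟏 (A n)) d ⊓ I₃ (𝟏 (A n)) (2 · d)

  min-I₃≤ : ∀ m d → d ≢ 𝟎 → min-I₃ (4 ℕ.+ m) d ≤ + C / M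
  min-I₃≤ m d d≢𝟎 with proj₂ (proj₂ (family m)) d d≢𝟎
  ... | inj₁ few = ℚ.≤-trans (ℚ.p⊓q≤p (I₃ (𝟏 (A (4 ℕ.+ m))) d) (I₃ (𝟏 (A (4 ℕ.+ m))) (2 · d))) (I₃≤ (A (4 ℕ.+ m)) d C M few)
  ... | inj₂ few = ℚ.≤-trans (ℚ.p⊓q≤q (I₃ (𝟏 (A (4 ℕ.+ m))) d) (I₃ (𝟏 (A (4 ℕ.+ m))) (2 · d))) (I₃≤ (A (4 ℕ.+ m)) (2 · d) C M few)

  max-min-I₃ : ∀ n → 4 ℕ.≤ n → ∃[ m ] IsMaxOverNonzero (min-I₃ n) m × m ≤ + C / M
  max-min-I₃ n 4≤n with m , refl ← ℕ.m≤n⇒∃[o]m+o≡n 4≤n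
    with d , d≢𝟎 , isMax ← max-over-nonzero 1<p (3 ℕ.+ m) (min-I₃ (4 ℕ.+ m)) =
    min-I₃ (4 ℕ.+ m) d , isMax , min-I₃≤ m d d≢𝟎

theorem1p2 : ∃[ c ] 0ℚ < c × (∃[ p₀ ]
    (∀ (p : ℕ) .{{_ : NonZero p}} → Prime p → p₀ ℕ.≤ p →
    ∃[ n₀ ] Σ[ A ∈ (∀ n → 𝒫 p n) ]
    (λ n → density (A n)) ⟶ ½ ×
    (∀ n → n₀ ℕ.≤ n →
    ∃[ m ] IsMaxOverNonzero (λ d → I₃ (𝟏 (A n)) d ⊓ I₃ (𝟏 (A n)) (2 · d)) m
    × m ≤ + 1 / 8 - c)))
theorem1p2 = + 1 / 8640 , from-yes (0ℚ ℚ.<? + 1 / 8640) , p-threshold , λ p p-prime p≥ →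
  let 1<p = ℕ.≤-trans (ℕ.m≤m+n 2 (p-threshold ℕ.∸ 2)) p≥
      open Family p 1<p 16185 129600 (unpopular-family p p-prime p≥)
  -- The bound 16185 / 129600 and 1/8 - 1/8640 both normalise to 1079 / 8640, so `max-min-I₃` has
  -- the required type by computation.
  in 4 , A , density-A , max-min-I₃
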